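{- Let $n\geq 8$ and let $a_0,a_1,a_2,a_3\in\mathbb{Z}$ satisfy $a_{i+1}-a_i\geq 2$ for $i=0,1,2$ and $a_3-a_0\leq n-2$. Then the complex $$\langle [\![a_3,a_2-1]\!],\ [\![a_2,a_1-1]\!],\ [\![a_1,a_0-1]\!],\ [\![a_0,a_3-1]\!]\rangle$$ on $I_n$ is a minimal complex generating $\mathsf{Mon}_n$.
   Context: For finite sets $A,I$, a language is a subset $L\subseteq A^I$. For finite sets $B,J$ and a function $f:B^J\to A^I$, the input window $\mathcal{W}_f(i)\subseteq J$ of $i\in I$ is the smallest $W\subseteq J$ such that for all $x,y\in B^J$ agreeing on $W$, $f(x)_i=f(y)_i$. The communication complex $K_f$ is the simplicial complex on vertex set $I$ whose simplices are the sets $S\subseteq I$ with $\bigcap_{i\in S}\mathcal{W}_f(i)\neq\emptyset$. A simplicial complex $K$ on $I$ generates $L$ if there exist finite sets $B,J$ and $f:B^J\to A^I$ with $f(B^J)=L$ and $K_f\subseteq K$; $K$ is minimal generating $L$ if it generates $L$ and no complex properly contained in $K$ generates $L$. $\mathsf{Mon}_n\subseteq\{0,1\}^n$ is the set of binary strings $x_0\ldots x_{n-1}$ that are non-decreasing or non-increasing. Positions $I_n=\{0,\ldots,n-1\}$ are identified with $\mathbb{Z}/n\mathbb{Z}$. For $a,b\in\mathbb{Z}$, the interval $[\![a,b]\!]=\{c\bmod n: c\in\mathbb{Z},\ a\leq c\leq b'\}$ where $b'$ is the representative of $b$ modulo $n$ with $a\leq b'<a+n$. $\langle S_0,\ldots,S_k\rangle$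 denotes the simplicial complex whose maximal simplices are $S_0,\ldots,S_k$. -}

module Defs where

open import Data.Nat using (ℕ; zero; suc; _≤_)
open import Data.Integer using (ℤ; +_; _-_; _%ℕ_)
open import Data.Fin using (Fin; toℕ)
open import Data.Fin.Subset using (Subset; _∈_; _⊆_)
open import Data.Bool using (Bool)
import Data.Bool as B
open import Data.Product using (Σ; _×_; ∃)
open import Data.Sum using (_⊎_)
open import Relation.Nullary using (¬_)
open import Relation.Binary.PropositionalEquality using (_≡_)

Language : ℕ → Set₁
Language n = (Fin n → Bool) → Set

Mon : (n : ℕ) → Language n
Mon n x = (∀ i j → toℕ i ≤ toℕ j → x i B.≤ x j)
        ⊎ (∀ i j → toℕ i ≤ toℕ j → x j B.≤ x i)

Family : ℕ → Set₁
Family n = Subset n → Set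

IsComplex : {n : ℕ} → Family n → Set
IsComplex K = ∀ S T → T ⊆ S → K S → K T

_⊑_ : {n : ℕ} → Family n → Family n → Set
K ⊑ K' = ∀ S → K S → K' S

_⊏_ : {n : ℕ} → Family n → Family n → Set
K ⊏ K' = (K ⊑ K') × ∃ λ S → K' S × ¬ K S

Fn : ℕ → ℕ → ℕ → Set
Fn b m n = (Fin m → Fin b) → (Fin n → Bool)

Determines : {b m n : ℕ} → Fn b m n → Fin n → Subset m → Set
Determines f i W = ∀ x y → (∀ j → j ∈ W → x j ≡ y j) → f x i ≡ f y i

IsWindow : {b m n : ℕ} → Fn b m n → Fin n → Subset m → Set
IsWindow f i W = Determines f i W × (∀ W' → Determines f i W' → W ⊆ W')

-- Given the windows Win i = W_f(i), the simplices of the communication complex K_f: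
-- sets S with ⋂_{i ∈ S} W_f(i) ≠ ∅ (empty intersection = J).
CommSimplex : {m n : ℕ} → (Fin n → Subset m) → Family n
CommSimplex {m} Win S = ∃ λ (j : Fin m) → ∀ i → i ∈ S → j ∈ Win i

Generates : {n : ℕ} → Family n → Language n → Set
Generates {n} K L =
  Σ ℕ λ b → Σ ℕ λ m → Σ (Fn b m n) λ f →
    ((∀ y → L y → ∃ λ x → ∀ i → f x i ≡ y i)
     × (∀ x → L (f x)))
    × Σ (Fin n → Subset m) λ Win →
        (∀ i → IsWindow f i (Win i))
        × (CommSimplex Win ⊑ K)

MinimalGenerating : {n : ℕ} → Family n → Language n → Set₁
MinimalGenerating {n} K L =
  Generates K L × (∀ (K' : Family n) → IsComplex K' → K' ⊏ K → ¬ Generates K' L)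

-- Integer residue modulo n (n = 0 never used).
modN : ℤ → ℕ → ℕ
modN z zero    = 0
modN z (suc k) = z %ℕ suc k

-- c ∈ [[a,b]] ⊆ ℤ/nℤ: c ≡ c' mod n for some a ≤ c' ≤ b', where b' ≡ b, a ≤ b' < a+n;
-- equivalently (c - a) mod n ≤ (b - a) mod n.
InInterval : (n : ℕ) → ℤ → ℤ → Fin n → Set
InInterval n a b c = modN ((+ toℕ c) - a) n ≤ modN (b - a) n

_⊆ᵢ_ : {n : ℕ} → Subset n → (Fin n → Set) → Set
S ⊆ᵢ P = ∀ i → i ∈ S → P i

K4 : (n : ℕ) → ℤ → ℤ → ℤ → ℤ → Family n
K4 n a₀ a₁ a₂ a₃ S =
    S ⊆ᵢ InInterval n a₃ (a₂ - + 1)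
  ⊎ S ⊆ᵢ InInterval n a₂ (a₁ - + 1)
  ⊎ S ⊆ᵢ InInterval n a₁ (a₀ - + 1)
  ⊎ S ⊆ᵢ InInterval n a₀ (a₃ - + 1)

{-# OPTIONS --safe #-}
module Submission where

-- Reading the positions from a₀ on and negating the letters that wrap around 0 preserves
-- monotonicity, so the four arcs [aᵢ, aᵢ₊₁) may be taken to be consecutive blocks A₀ A₁ A₂ A₃
-- of a linear word; S is a simplex of the complex iff it misses one of them.
--
-- Generation: four inputs suffice, input k being invisible to Aₖ. Each input carries a colour
-- in {0,1,2} and a threshold. The colours produce a monotone word with two letters per arc,
-- and every block is allowed to change its letter; the thresholds place this change anywhere.
--
-- Minimality: by rotation, the missing simplex may be assumed to be disjoint from A₀. Then
-- every input misses A₁, A₂ or A₃ (groups 1, 2, 3), or A₀ and one more position c (group 0).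
-- Let z, y, u be preimages of the words 0|01|1|1, 1|1|10|0, 0|0|0|01. If the groups 1, 2, 3
-- are fixed and A₀ is constant, changing group 0 cannot move the change of letter across the
-- whole of A₁A₂A₃, because the inputs that ignore c cannot move it across c. Writing a cell
-- as (x₀,x₁,x₂,x₃), this forces the last letter at (z,y,u,y) to be 0 and the first letter of
-- A₁ at (u,y,z,y) to be 1; hence the first letter of A₁ is 1 at (z,u,u,z) and the last letter
-- is 0 at (u,u,z,z). Splicing the cells (·,u,u,z) and (·,u,z,z) along A₂, which ignores
-- group 2, gives an increasing word which group 0 moves all the way, a contradiction.

open import Defs
open import Data.Bool using (Bool; true; false; not; _xor_; if_then_else_; b≤b; f≤t)
import Data.Bool as B
import Data.Bool.Properties as Bool
open import Data.Empty using (⊥)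
open import Data.Fin using (Fin; toℕ; fromℕ<; combine; remQuot; finToFun; funToFin)
import Data.Fin as Fin
open import Data.Fin.Patterns using (0F; 1F; 2F; 3F)
open import Data.Fin.Properties using (all?; any?; ¬∀⟶∃¬; toℕ<n; toℕ-fromℕ<; fromℕ<-toℕ;
  toℕ-injective; remQuot-combine; finToFun-funToFin) renaming (_≟_ to _≟ᶠ_; <-cmp to <-cmpᶠ)
open import Data.Fin.Subset using (Subset; _∈_; _⊆_; ⁅_⁆; ∁)
import Data.Fin.Subset as Sub
open import Data.Fin.Subset.Induction using (⊂-wellFounded; Acc; acc)
open import Data.Fin.Subset.Properties using (_∈?_; x∈p⇒p-x⊂p; x∈p∧x≢y⇒x∈p-y; p─q⊆p;
  x∈⁅x⁆; x∉p⇒x∈∁p; x∈∁p⇒x∉p; x≢y⇒x∉⁅y⁆)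
open import Data.Integer using (ℤ; +_; -[1+_]; _-_; _/ℕ_; +≤+)
import Data.Integer as Z
open import Data.Integer.DivMod using (n%ℕd<d; a≡a%ℕn+[a/ℕn]*n)
import Data.Integer.Properties as Z
open import Data.Integer.Solver using (module +-*-Solver)
open import Data.Nat using (ℕ; zero; suc; _+_; _*_; _∸_; _≤_; _<_; _<?_; _<ᵇ_; z≤n; s≤s;
  _≤′_; ≤′-refl; ≤′-step; >-nonZero)
open import Data.Nat.Properties
open import Data.Product using (∃; ∃₂; _×_; _,_; proj₁; proj₂; map₂)
import Data.Sum as Sum
open import Data.Sum using (_⊎_; inj₁; inj₂)
open import Data.Vec using (lookup; tabulate)
open import Data.Vec.Properties using ([]=⇒lookup; lookup⇒[]=; lookup∘tabulate)
open import Function using (_∘_; id; flip)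
open import Relation.Binary using (Rel; Reflexive; Transitive; tri<; tri≈; tri>)
open import Relation.Binary.PropositionalEquality
open import Relation.Nullary using (Dec; yes; no; ¬_; contradiction)
open import Relation.Nullary.Decidable using (map′; dec-true; dec-false; toWitness;
  decidable-stable; _→-dec_; _×-dec_; _⊎-dec_)

-- Existence of input windows.

module _ {b m n : ℕ} (f : Fn b m n) (i : Fin n) where

  -- Splice the inputs: `z` follows `x` on `U` and `y` elsewhere. It agrees with `y` on `V`, because
  -- `x` and `y` agree on the common part of `U` and `V`.
  determines-∩ : ∀ {U V W} → (∀ {j} → j ∈ U → j ∈ V → j ∈ W) →
    Determines f i U → Determines f i V → Determines f i W
  determines-∩ {U} {V} {W} UV⊆W detU detV x y agree = trans (detU x z x≡z) (detV z y z≡y)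
    where
    z : Fin m → Fin b
    z j with j ∈? U
    ... | yes _ = x j
    ... | no  _ = y j
    x≡z : ∀ j → j ∈ U → x j ≡ z j
    x≡z j j∈U with j ∈? U
    ... | yes _ = refl
    ... | no j∉U = contradiction j∈U j∉U
    z≡y : ∀ j → j ∈ V → z j ≡ y j
    z≡y j j∈V with j ∈? U
    ... | yes j∈U = agree j (UV⊆W j∈U j∈V)
    ... | no  _ = refl

  -- Inputs are enumerated through their finite codes; `ext` replaces function extensionality when
  -- decoding.
  determines? : (∀ x y → x ≗ y → f x i ≡ f y i) → ∀ W → Dec (Determines f i W)
  determines? ext W = map′ decode (λ det p q → det (finToFun p) (finToFun q))
    (all? λ p → all? λ q →
      (all? λ j → (j ∈? W) →-dec (finToFun p j ≟ᶠ finToFun q j))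
      →-dec (f (finToFun p) i Bool.≟ f (finToFun q) i))
    where
    decode : (∀ p q → (∀ j → j ∈ W → finToFun {b} {m} p j ≡ finToFun q j) →
      f (finToFun p) i ≡ f (finToFun q) i) → Determines f i W
    decode det x y agree = trans (ext x _ (sym ∘ finToFun-funToFin x))
      (trans (det (funToFin x) (funToFin y)
        (λ j j∈W → trans (finToFun-funToFin x j) (trans (agree j j∈W) (sym (finToFun-funToFin y j)))))
      (ext _ y (finToFun-funToFin y)))

  window : ∀ D → Determines f i D → ∃ λ W → IsWindow f i W × W ⊆ D
  window D detD = shrink D (⊂-wellFounded D) detD
    where
    ext : ∀ x y → x ≗ y → f x i ≡ f y i
    ext x y x≗y = detD x y (λ j _ → x≗y j)
    shrink : ∀ D → Acc Sub._⊂_ D → Determines f i D → ∃ λ W → IsWindow f i W × W ⊆ D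
    shrink D (acc rec) det
      with any? (λ j → (j ∈? D) ×-dec determines? ext (D Sub.- j))
    ... | yes (j , j∈D , det′) with shrink _ (rec (x∈p⇒p-x⊂p j∈D)) det′
    ...   | W , isW , W⊆ = W , isW , p─q⊆p D _ ∘ W⊆
    shrink D (acc rec) det | no none = D , (det , minimal) , id
      where
      minimal : ∀ V → Determines f i V → D ⊆ V
      minimal V detV {j} j∈D with j ∈? V
      ... | yes j∈V = j∈V
      ... | no  j∉V = contradiction
        (j , j∈D , determines-∩ (λ k∈D k∈V → x∈p∧x≢y⇒x∈p-y k∈D λ { refl → j∉V k∈V }) det detV) none

-- Monotone words and their letter changes.

Word : Set
Word = ℕ → Bool

Increasing Decreasing Monotone : ℕ → Word → Set
Increasing n v = ∀ s t → s ≤ t → t < n → v s B.≤ v t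
Decreasing n v = ∀ s t → s ≤ t → t < n → v t B.≤ v s
Monotone n v = Increasing n v ⊎ Decreasing n v

Monotone-resp : ∀ {n v w} → (∀ t → t < n → v t ≡ w t) → Monotone n v → Monotone n w
Monotone-resp v≗w (inj₁ inc) = inj₁ λ s t s≤t t<n →
  subst₂ B._≤_ (v≗w s (≤-<-trans s≤t t<n)) (v≗w t t<n) (inc s t s≤t t<n)
Monotone-resp v≗w (inj₂ dec) = inj₂ λ s t s≤t t<n →
  subst₂ B._≤_ (v≗w t t<n) (v≗w s (≤-<-trans s≤t t<n)) (dec s t s≤t t<n)

not-anti : ∀ {a b} → a B.≤ b → not b B.≤ not a
not-anti b≤b = b≤b
not-anti f≤t = f≤t

Monotone-not : ∀ {n v} → Monotone n v → Monotone n (not ∘ v)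
Monotone-not (inj₁ inc) = inj₂ λ s t s≤t t<n → not-anti (inc s t s≤t t<n)
Monotone-not (inj₂ dec) = inj₁ λ s t s≤t t<n → not-anti (dec s t s≤t t<n)

≤-reflects-false : ∀ {a b} → a B.≤ b → b ≡ false → a ≡ false
≤-reflects-false b≤b refl = refl

≤-preserves-true : ∀ {a b} → a B.≤ b → a ≡ true → b ≡ true
≤-preserves-true b≤b refl = refl

step : ℕ → Bool → Word
step p b t = (p <ᵇ t) xor b

step-after : ∀ p {t} b → p < t → step p b t ≡ not b
step-after p b p<t = cong (_xor b) (dec-true (_ <? _) p<t)

step-before : ∀ p {t} b → t ≤ p → step p b t ≡ b
step-before p b t≤p = cong (_xor b) (dec-false (_ <? _) (≤⇒≯ t≤p))

step-monotone : ∀ n p b → Monotone n (step p b)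
step-monotone n p false = inj₁ λ s t s≤t _ → inc s≤t
  where
  inc : ∀ {s t} → s ≤ t → step p false s B.≤ step p false t
  inc {s} {t} s≤t with p <? s
  ... | yes p<s rewrite step-after p false (<-≤-trans p<s s≤t) = Bool.≤-maximum _
  ... | no  p≮s rewrite step-before p false (≮⇒≥ p≮s) = Bool.≤-minimum _
step-monotone n p true = Monotone-resp
  (λ t _ → not-xor-false (p <ᵇ t)) (Monotone-not (step-monotone n p false))
  where
  not-xor-false : ∀ a → not (a xor false) ≡ a xor true
  not-xor-false true  = refl
  not-xor-false false = refl

-- A monotone word changes its letter at most once, so two unequal neighbours fix all of it. This is
-- how two adjacent letters inside one arc control the other arcs.
monotone-jump : ∀ {n v p} b → Monotone n v → suc p < n → v p ≡ b → v (suc p) ≡ not b →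
  ∀ t → t < n → v t ≡ step p b t
monotone-jump {n} {v} {p} b mon p+1<n vp vp+1 t t<n with p <? t
monotone-jump {n} {v} {p} b (inj₁ inc) p+1<n vp vp+1 t t<n | yes p<t
  with b | inc p (suc p) (n≤1+n p) p+1<n
... | false | _ = trans (≤-preserves-true (inc (suc p) t p<t t<n) vp+1) (sym (step-after p false p<t))
... | true  | le with () ← trans (sym (≤-preserves-true le vp)) vp+1
monotone-jump {n} {v} {p} b (inj₂ dec) p+1<n vp vp+1 t t<n | yes p<t
  with b | dec p (suc p) (n≤1+n p) p+1<n
... | true  | _ = trans (≤-reflects-false (dec (suc p) t p<t t<n) vp+1) (sym (step-after p true p<t))
... | false | le with () ← trans (sym vp+1) (≤-reflects-false le vp)
monotone-jump {n} {v} {p} b (inj₁ inc) p+1<n vp vp+1 t t<n | no p≮t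
  with b | inc p (suc p) (n≤1+n p) p+1<n
... | false | _ = trans (≤-reflects-false (inc t p (≮⇒≥ p≮t) (<-trans (n<1+n p) p+1<n)) vp)
  (sym (step-before p false (≮⇒≥ p≮t)))
... | true  | le with () ← trans (sym (≤-preserves-true le vp)) vp+1
monotone-jump {n} {v} {p} b (inj₂ dec) p+1<n vp vp+1 t t<n | no p≮t
  with b | dec p (suc p) (n≤1+n p) p+1<n
... | true  | _ = trans (≤-preserves-true (dec t p (≮⇒≥ p≮t) (<-trans (n<1+n p) p+1<n)) vp)
  (sym (step-before p true (≮⇒≥ p≮t)))
... | false | le with () ← trans (sym vp+1) (≤-reflects-false le vp)

monotone-from-false : ∀ {n v} → Monotone n v → v 0 ≡ false → Increasing n v
monotone-from-false (inj₁ inc) _ = inc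
monotone-from-false {v = v} (inj₂ dec) v0 s t s≤t t<n
  rewrite ≤-reflects-false (dec 0 t z≤n t<n) v0
        | ≤-reflects-false (dec 0 s z≤n (≤-<-trans s≤t t<n)) v0 = b≤b

monotone-from-true : ∀ {n v} → Monotone n v → v 0 ≡ true → Decreasing n v
monotone-from-true (inj₂ dec) _ = dec
monotone-from-true {v = v} (inj₁ inc) v0 s t s≤t t<n
  rewrite ≤-preserves-true (inc 0 t z≤n t<n) v0
        | ≤-preserves-true (inc 0 s z≤n (≤-<-trans s≤t t<n)) v0 = b≤b

-- The obstruction, for a linear word cut into four arcs.

data Class : Set where
  omit₀ : ℕ → Class
  omit₁ omit₂ omit₃ : Class

Arc : ℕ → ℕ → ℕ → Set
Arc l r t = l ≤ t × t < r

-- Positions run from `0` to `q` and are cut at `e₁`, `e₂`, `e₃`. The inequalities give each of the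
-- last three arcs room for a jump, that is two letters, and `A₀` at least one.
module Obstruction (e₁ e₂ e₃ q : ℕ)
  (0<e₁ : 0 < e₁) (e₁+1<e₂ : suc e₁ < e₂) (e₂+1<e₃ : suc e₂ < e₃) (e₃<q : e₃ < q)
  where

  Omits : Class → ℕ → Set
  Omits (omit₀ c) t = t < e₁ ⊎ t ≡ c
  Omits omit₁     t = Arc e₁ e₂ t
  Omits omit₂     t = Arc e₂ e₃ t
  Omits omit₃     t = Arc e₃ (suc q) t

  module _ {J X : Set} (κ : J → Class)
    (κ-bound : ∀ j {c} → κ j ≡ omit₀ c → Arc e₁ (suc q) c) where

    Input : Set
    Input = J → X

    private
      hybrid : Input → Input → ℕ → Input
      hybrid v w d j with κ j
      ... | omit₀ c = if c <ᵇ d then w j else v j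
      ... | _       = v j

      hybrid-below : ∀ v w {d j c} → κ j ≡ omit₀ c → c < d → hybrid v w d j ≡ w j
      hybrid-below v w {d} {j} {c} eq c<d rewrite eq | dec-true (c <? d) c<d = refl

      hybrid-above : ∀ v w {d j c} → κ j ≡ omit₀ c → d ≤ c → hybrid v w d j ≡ v j
      hybrid-above v w {d} {j} {c} eq d≤c rewrite eq | dec-false (c <? d) (≤⇒≯ d≤c) = refl

    -- Replace the class omit₀ c coordinates of v by those of w, in increasing order of c:
    -- the bit at c does not see this replacement, and by monotonicity it hands its value
    -- over to the bit at c + 1.
    true-propagates : (β : Input → Word) →
      (∀ x s t → e₁ ≤ s → s ≤ t → t ≤ q → β x s B.≤ β x t) →
      (∀ t x x′ → e₁ ≤ t → t ≤ q →
        (∀ j {c} → κ j ≡ omit₀ c → c ≢ t → x j ≡ x′ j) → β x t ≡ β x′ t) →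
      ∀ v w → β v e₁ ≡ true → β w q ≡ true
    true-propagates β inc indep v w βv =
      -- Among the group 0 coordinates, only those with `c = q` still follow `v` here, and the
      -- letter at `q` does not see them.
      trans (indep q w (hybrid v w q) e₁≤q ≤-refl
        (λ j eq c≢q → sym (hybrid-below v w eq (≤∧≢⇒< (≤-pred (proj₂ (κ-bound j eq))) c≢q))))
      (sweep (≤⇒≤′ e₁≤q) ≤-refl)
      where
      e₁≤q : e₁ ≤ q
      e₁≤q = ≤-trans (n≤1+n e₁) (<⇒≤ (<-trans e₁+1<e₂ (<-trans (<-trans (n<1+n e₂) e₂+1<e₃) e₃<q)))
      sweep : ∀ {d} → e₁ ≤′ d → d ≤ q → β (hybrid v w d) d ≡ true
      sweep ≤′-refl e₁≤q = trans
        (indep e₁ _ v ≤-refl e₁≤q (λ j eq _ → hybrid-above v w eq (proj₁ (κ-bound j eq)))) βv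
      sweep (≤′-step {d} e₁≤d) d<q = ≤-preserves-true
        (inc _ d (suc d) (≤′⇒≤ e₁≤d) (n≤1+n d) d<q)
        (trans (indep d _ _ (≤′⇒≤ e₁≤d) (<⇒≤ d<q) unseen) (sweep e₁≤d (<⇒≤ d<q)))
        where
        unseen : ∀ j {c} → κ j ≡ omit₀ c → c ≢ d → hybrid v w (suc d) j ≡ hybrid v w d j
        unseen j {c} eq c≢d with c <? d
        ... | yes c<d = trans (hybrid-below v w eq (m<n⇒m<1+n c<d)) (sym (hybrid-below v w eq c<d))
        ... | no  c≮d = trans (hybrid-above v w eq (≤∧≢⇒< (≮⇒≥ c≮d) (c≢d ∘ sym)))
                              (sym (hybrid-above v w eq (≮⇒≥ c≮d)))

    private
      pick : Class → Input → Input → Input → Input → Input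
      pick (omit₀ _) x₀ _ _ _ = x₀
      pick omit₁     _ x₁ _ _ = x₁
      pick omit₂     _ _ x₂ _ = x₂
      pick omit₃     _ _ _ x₃ = x₃

      -- The cell (x₀,x₁,x₂,x₃): each coordinate follows the input chosen for its group.
      mix : Input → Input → Input → Input → Input
      mix x₀ x₁ x₂ x₃ j = pick (κ j) x₀ x₁ x₂ x₃ j

    module _ (g : Input → Word) (mono : ∀ x → Monotone (suc q) (g x))
      (reads : ∀ t → t ≤ q → ∀ x x′ → (∀ j → ¬ Omits (κ j) t → x j ≡ x′ j) → g x t ≡ g x′ t)
      where

      private
        e₁<e₂ : e₁ < e₂
        e₁<e₂ = <-trans (n<1+n e₁) e₁+1<e₂
        e₂<e₃ : e₂ < e₃
        e₂<e₃ = <-trans (n<1+n e₂) e₂+1<e₃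
        e₂≤q : e₂ ≤ q
        e₂≤q = <⇒≤ (<-trans e₂<e₃ e₃<q)
        e₁≤q : e₁ ≤ q
        e₁≤q = ≤-trans (<⇒≤ e₁<e₂) e₂≤q
        e₁≤e₃ : e₁ ≤ e₃
        e₁≤e₃ = <⇒≤ (<-trans e₁<e₂ e₂<e₃)

        free₀ : ∀ {t} x₀ x₀′ x₁ x₂ x₃ → t < e₁ → g (mix x₀ x₁ x₂ x₃) t ≡ g (mix x₀′ x₁ x₂ x₃) t
        free₀ {t} x₀ x₀′ x₁ x₂ x₃ t<e₁ =
          reads t (≤-trans (<⇒≤ t<e₁) e₁≤q) _ _ λ j → same j (κ j)
          where
          same : ∀ j c → ¬ Omits c t → pick c x₀ x₁ x₂ x₃ j ≡ pick c x₀′ x₁ x₂ x₃ j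
          same j (omit₀ _) seen = contradiction (inj₁ t<e₁) seen
          same j omit₁ _ = refl
          same j omit₂ _ = refl
          same j omit₃ _ = refl

        free₁ : ∀ {t} x₀ x₁ x₁′ x₂ x₃ → Arc e₁ e₂ t → g (mix x₀ x₁ x₂ x₃) t ≡ g (mix x₀ x₁′ x₂ x₃) t
        free₁ {t} x₀ x₁ x₁′ x₂ x₃ t∈ =
          reads t (≤-trans (<⇒≤ (proj₂ t∈)) e₂≤q) _ _ λ j → same j (κ j)
          where
          same : ∀ j c → ¬ Omits c t → pick c x₀ x₁ x₂ x₃ j ≡ pick c x₀ x₁′ x₂ x₃ j
          same j (omit₀ _) _ = refl
          same j omit₁ seen = contradiction t∈ seen
          same j omit₂ _ = refl
          same j omit₃ _ = refl

        free₂ : ∀ {t} x₀ x₁ x₂ x₂′ x₃ → Arc e₂ e₃ t → g (mix x₀ x₁ x₂ x₃) t ≡ g (mix x₀ x₁ x₂′ x₃) t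
        free₂ {t} x₀ x₁ x₂ x₂′ x₃ t∈ =
          reads t (<⇒≤ (<-trans (proj₂ t∈) e₃<q)) _ _ λ j → same j (κ j)
          where
          same : ∀ j c → ¬ Omits c t → pick c x₀ x₁ x₂ x₃ j ≡ pick c x₀ x₁ x₂′ x₃ j
          same j (omit₀ _) _ = refl
          same j omit₁ _ = refl
          same j omit₂ seen = contradiction t∈ seen
          same j omit₃ _ = refl

        free₃ : ∀ {t} x₀ x₁ x₂ x₃ x₃′ → Arc e₃ (suc q) t → g (mix x₀ x₁ x₂ x₃) t ≡ g (mix x₀ x₁ x₂ x₃′) t
        free₃ {t} x₀ x₁ x₂ x₃ x₃′ t∈ = reads t (≤-pred (proj₂ t∈)) _ _ λ j → same j (κ j)
          where
          same : ∀ j c → ¬ Omits c t → pick c x₀ x₁ x₂ x₃ j ≡ pick c x₀ x₁ x₂ x₃′ j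
          same j (omit₀ _) _ = refl
          same j omit₁ _ = refl
          same j omit₂ _ = refl
          same j omit₃ seen = contradiction t∈ seen

        mix-diag : ∀ x t → t ≤ q → g (mix x x x x) t ≡ g x t
        mix-diag x t t≤q = reads t t≤q _ _ λ j _ → same j (κ j)
          where
          same : ∀ j c → pick c x x x x j ≡ x j
          same j (omit₀ _) = refl
          same j omit₁ = refl
          same j omit₂ = refl
          same j omit₃ = refl

        reads₀ : ∀ x₁ x₂ x₃ t x x′ → e₁ ≤ t → t ≤ q →
          (∀ j {c} → κ j ≡ omit₀ c → c ≢ t → x j ≡ x′ j) →
          g (mix x x₁ x₂ x₃) t ≡ g (mix x′ x₁ x₂ x₃) t
        reads₀ x₁ x₂ x₃ t x x′ e₁≤t t≤q agree = reads t t≤q _ _ λ j → same j (κ j) refl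
          where
          same : ∀ j c → κ j ≡ c → ¬ Omits c t → pick c x x₁ x₂ x₃ j ≡ pick c x′ x₁ x₂ x₃ j
          same j (omit₀ c) eq seen = agree j eq λ c≡t → seen (inj₂ (sym c≡t))
          same j omit₁ _ _ = refl
          same j omit₂ _ _ = refl
          same j omit₃ _ _ = refl

      obstruction : ∀ z y u →
        (∀ t → t ≤ q → g z t ≡ step e₁ false t) →
        (∀ t → t ≤ q → g y t ≡ step e₂ true  t) →
        (∀ t → t ≤ q → g u t ≡ step e₃ false t) → ⊥
      obstruction z y u gz gy gu = contradiction (trans (sym contra) fact₄) λ ()
        where
        A₁-first : Arc e₁ e₂ e₁
        A₁-first = ≤-refl , e₁<e₂
        A₂-first : Arc e₂ e₃ e₂
        A₂-first = ≤-refl , e₂<e₃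
        A₃-last : Arc e₃ (suc q) q
        A₃-last = <⇒≤ e₃<q , n<1+n q

        -- The letters at `e₁` and `e₁ + 1` lie in `A₁` and ignore group 1, so they jump as in the
        -- word of `z`, and the jump fixes the whole word. `y-word` and `u-word` use `A₂` and `A₃`
        -- in the same way.
        z-word : ∀ x₁ t → t ≤ q → g (mix z x₁ z z) t ≡ step e₁ false t
        z-word x₁ t t≤q = monotone-jump false (mono _) (s≤s (≤-trans e₁<e₂ e₂≤q))
          (at e₁ A₁-first (step-before e₁ false ≤-refl))
          (at (suc e₁) (n≤1+n e₁ , e₁+1<e₂) (step-after e₁ false (n<1+n e₁))) t (s≤s t≤q)
          where
          at : ∀ t {b} → Arc e₁ e₂ t → step e₁ false t ≡ b → g (mix z x₁ z z) t ≡ b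
          at t t∈ eq = trans (free₁ z x₁ z z z t∈)
            (trans (mix-diag z t (≤-trans (<⇒≤ (proj₂ t∈)) e₂≤q))
              (trans (gz t (≤-trans (<⇒≤ (proj₂ t∈)) e₂≤q)) eq))

        y-word : ∀ x₂ t → t ≤ q → g (mix y y x₂ y) t ≡ step e₂ true t
        y-word x₂ t t≤q = monotone-jump true (mono _) (s≤s (≤-trans e₂<e₃ (<⇒≤ e₃<q)))
          (at e₂ A₂-first (step-before e₂ true ≤-refl))
          (at (suc e₂) (n≤1+n e₂ , e₂+1<e₃) (step-after e₂ true (n<1+n e₂))) t (s≤s t≤q)
          where
          at : ∀ t {b} → Arc e₂ e₃ t → step e₂ true t ≡ b → g (mix y y x₂ y) t ≡ b
          at t t∈ eq = trans (free₂ y y x₂ y y t∈)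
            (trans (mix-diag y t (<⇒≤ (<-trans (proj₂ t∈) e₃<q)))
              (trans (gy t (<⇒≤ (<-trans (proj₂ t∈) e₃<q))) eq))

        u-word : ∀ x₃ t → t ≤ q → g (mix u u u x₃) t ≡ step e₃ false t
        u-word x₃ t t≤q = monotone-jump false (mono _) (s≤s e₃<q)
          (at e₃ (≤-refl , s≤s (<⇒≤ e₃<q)) (step-before e₃ false ≤-refl))
          (at (suc e₃) (n≤1+n e₃ , s≤s e₃<q) (step-after e₃ false (n<1+n e₃))) t (s≤s t≤q)
          where
          at : ∀ t {b} → Arc e₃ (suc q) t → step e₃ false t ≡ b → g (mix u u u x₃) t ≡ b
          at t t∈ eq = trans (free₃ u u u x₃ u t∈)
            (trans (mix-diag u t (≤-pred (proj₂ t∈))) (trans (gu t (≤-pred (proj₂ t∈))) eq))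

        -- The first letter is 1 whatever group 0 holds, so these words decrease. Their negations
        -- increase, and `true-propagates` carries a 1 of the negation from `e₁` to `q`.
        falling : ∀ x₂ v w → g (mix v y x₂ y) e₁ ≡ false → g (mix w y x₂ y) q ≡ false
        falling x₂ v w eq = Bool.not-injective (true-propagates (λ x → not ∘ g (mix x y x₂ y))
          (λ x s t _ s≤t t≤q → not-anti (monotone-from-true (mono _) (starts-true x) s t s≤t (s≤s t≤q)))
          (λ t x x′ e₁≤t t≤q agree → cong not (reads₀ y x₂ y t x x′ e₁≤t t≤q agree))
          v w (cong not eq))
          where
          starts-true : ∀ x → g (mix x y x₂ y) 0 ≡ true
          starts-true x = trans (free₀ x y y x₂ y 0<e₁)
            (trans (y-word x₂ 0 z≤n) (step-before e₂ true z≤n))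

        -- At `e₁` the cell (u,y,u,y) shows the 0 of (u,u,u,y), since `A₁` ignores group 1. Then
        -- `falling` replaces `u` by `z` in group 0, and `A₃` ignores group 3.
        fact₁ : g (mix z y u z) q ≡ false
        fact₁ = trans (free₃ z y u z y A₃-last) (falling u u z
          (trans (free₁ u y u u y A₁-first) (trans (u-word y e₁ e₁≤q) (step-before e₃ false e₁≤e₃))))

        -- A 0 here would be a 0 at (u,y,z,y), and `falling` would give the last letter 0 at
        -- (z,y,z,y), where `A₃` shows the final 1 of (z,y,z,z).
        fact₂ : g (mix u u z y) e₁ ≡ true
        fact₂ with g (mix u u z y) e₁ in eq
        ... | true  = refl
        ... | false = trans
          (sym (falling z u z (trans (free₁ u y u z y A₁-first) eq)))
          (trans (free₃ z y z y z A₃-last)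
            (trans (z-word y q ≤-refl) (step-after e₁ false (<-≤-trans e₁<e₂ e₂≤q))))

        -- The word of (z,y,u,z) has 1 at `e₂`, copied from (z,y,z,z), and ends in 0 by `fact₁`.
        -- Hence it decreases and already has 1 at `e₁`.
        fact₃ : g (mix z u u z) e₁ ≡ true
        fact₃ = trans (free₁ z u y u z A₁-first) (by-cases (mono (mix z y u z)))
          where
          e₂-true : g (mix z y u z) e₂ ≡ true
          e₂-true = trans (free₂ z y u z z A₂-first)
            (trans (z-word y e₂ e₂≤q) (step-after e₁ false e₁<e₂))
          by-cases : Monotone (suc q) (g (mix z y u z)) → g (mix z y u z) e₁ ≡ true
          by-cases (inj₂ dec) = ≤-preserves-true (dec e₁ e₂ (<⇒≤ e₁<e₂) (s≤s e₂≤q)) e₂-true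
          by-cases (inj₁ inc) = contradiction
            (trans (sym fact₁) (≤-preserves-true (inc e₂ q e₂≤q ≤-refl) e₂-true)) λ ()

        -- The word of (u,u,z,y) has 1 at `e₁` by `fact₂` and 0 at `e₂`, copied from (u,u,u,y).
        -- Hence it decreases and ends in 0.
        fact₄ : g (mix u u z z) q ≡ false
        fact₄ = trans (free₃ u u z z y A₃-last) (by-cases (mono (mix u u z y)))
          where
          e₂-false : g (mix u u z y) e₂ ≡ false
          e₂-false = trans (free₂ u u z u y A₂-first)
            (trans (u-word y e₂ e₂≤q) (step-before e₃ false (<⇒≤ e₂<e₃)))
          by-cases : Monotone (suc q) (g (mix u u z y)) → g (mix u u z y) q ≡ false
          by-cases (inj₂ dec) = ≤-reflects-false (dec e₂ q e₂≤q ≤-refl) e₂-false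
          by-cases (inj₁ inc) = contradiction
            (trans (sym e₂-false) (≤-preserves-true (inc e₁ e₂ (<⇒≤ e₁<e₂) (s≤s e₂≤q)) fact₂)) λ ()

        -- A₂ ignores group 2, so the two cells agree at e₂ and the splice is increasing.
        rising : Input → Word
        rising x t with t <? e₂
        ... | yes _ = g (mix x u u z) t
        ... | no  _ = g (mix x u z z) t

        -- Position 0 lies in `A₀`, so for every `x` its letter is that of (u,u,u,z), namely 0. For
        -- `inc-z` the cell is (z,u,z,z).
        inc-u : ∀ x → Increasing (suc q) (g (mix x u u z))
        inc-u x = monotone-from-false (mono _)
          (trans (free₀ x u u u z 0<e₁) (trans (u-word z 0 z≤n) (step-before e₃ false z≤n)))

        inc-z : ∀ x → Increasing (suc q) (g (mix x u z z))
        inc-z x = monotone-from-false (mono _)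
          (trans (free₀ x z u z z 0<e₁) (trans (z-word u 0 z≤n) (step-before e₁ false z≤n)))

        rising-inc : ∀ x s t → e₁ ≤ s → s ≤ t → t ≤ q → rising x s B.≤ rising x t
        rising-inc x s t _ s≤t t≤q with s <? e₂ | t <? e₂
        ... | yes _    | yes _    = inc-u x s t s≤t (s≤s t≤q)
        ... | no  _    | no  _    = inc-z x s t s≤t (s≤s t≤q)
        ... | no  s≮e₂ | yes t<e₂ = contradiction (≤-<-trans s≤t t<e₂) s≮e₂
        ... | yes s<e₂ | no  t≮e₂ = Bool.≤-trans (inc-u x s e₂ (<⇒≤ s<e₂) (s≤s e₂≤q))
          (Bool.≤-trans (Bool.≤-reflexive (free₂ x u u z z A₂-first))
            (inc-z x e₂ t (≮⇒≥ t≮e₂) (s≤s t≤q)))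

        rising-reads : ∀ t x x′ → e₁ ≤ t → t ≤ q →
          (∀ j {c} → κ j ≡ omit₀ c → c ≢ t → x j ≡ x′ j) → rising x t ≡ rising x′ t
        rising-reads t x x′ e₁≤t t≤q agree with t <? e₂
        ... | yes _ = reads₀ u u z t x x′ e₁≤t t≤q agree
        ... | no  _ = reads₀ u z z t x x′ e₁≤t t≤q agree

        contra : g (mix u u z z) q ≡ true
        contra = trans (sym rising-q)
          (true-propagates rising rising-inc rising-reads z u (trans rising-e₁ fact₃))
          where
          rising-e₁ : rising z e₁ ≡ g (mix z u u z) e₁
          rising-e₁ with e₁ <? e₂
          ... | yes _ = refl
          ... | no e₁≮e₂ = contradiction e₁<e₂ e₁≮e₂
          rising-q : rising u q ≡ g (mix u u z z) q
          rising-q with q <? e₂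
          ... | yes q<e₂ = contradiction q<e₂ (≤⇒≯ e₂≤q)
          ... | no _ = refl

-- Rotation of words with negation of the wrapped letters.

wrap : ℕ → ℕ → ℕ
wrap n i = if i <ᵇ n then i else i ∸ n

twist : ℕ → ℕ → Bool → Bool
twist n i b = if i <ᵇ n then b else not b

-- For `r ≤ n` this is the window of length `n` starting at `r` in the continuation w(t + n) = not
-- w(t). If `w` is monotone, the continuation changes its letter exactly once in any `n` consecutive
-- steps, so the window is monotone.
rotate : ℕ → ℕ → Word → Word
rotate n r w t = twist n (r + t) (w (wrap n (r + t)))

wrap-low : ∀ {n i} → i < n → wrap n i ≡ i
wrap-low {n} {i} i<n rewrite dec-true (i <? n) i<n = refl

wrap-high : ∀ {n i} → n ≤ i → wrap n i ≡ i ∸ n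
wrap-high {n} {i} n≤i rewrite dec-false (i <? n) (≤⇒≯ n≤i) = refl

wrap< : ∀ {n r t} → r ≤ n → t < n → wrap n (r + t) < n
wrap< {n} {r} {t} r≤n t<n with r + t <? n
... | yes r+t<n = subst (_< n) (sym (wrap-low r+t<n)) r+t<n
... | no  r+t≮n = subst (_< n) (sym (wrap-high (≮⇒≥ r+t≮n)))
  (m<n+o⇒m∸n<o (r + t) n {{>-nonZero (≤-<-trans z≤n t<n)}} (+-mono-≤-< r≤n t<n))

rotate-low : ∀ {n} r w {t} → r + t < n → rotate n r w t ≡ w (r + t)
rotate-low {n} r w {t} r+t<n rewrite dec-true (r + t <? n) r+t<n = refl

rotate-high : ∀ {n} r w {t} → n ≤ r + t → rotate n r w t ≡ not (w (r + t ∸ n))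
rotate-high {n} r w {t} n≤r+t rewrite dec-false (r + t <? n) (≤⇒≯ n≤r+t) = refl

rotate-not : ∀ n r w t → rotate n r (not ∘ w) t ≡ not (rotate n r w t)
rotate-not n r w t with r + t <ᵇ n
... | true  = refl
... | false = refl

-- If `r = n`, all letters are negated. Otherwise, if `w r` is 1, the window starts with 1s and goes
-- on with the negated, hence decreasing, prefix; if `w r` is 0, the prefix is all 0 and returns as
-- 1s.
rotate-increasing : ∀ {n r w} → r ≤ n → Increasing n w → Monotone n (rotate n r w)
rotate-increasing {n} {r} {w} r≤n inc with r <? n | w r in wr
... | no r≮n | _ = inj₂ λ s t s≤t t<n → subst₂ B._≤_ (sym (high t)) (sym (high s))
    (not-anti (inc s t s≤t t<n))
  where
  high : ∀ t → rotate n r w t ≡ not (w t)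
  high t rewrite ≤-antisym r≤n (≮⇒≥ r≮n) =
    trans (rotate-high n w (m≤m+n n t)) (cong (not ∘ w) (m+n∸m≡n n t))
... | yes r<n | true = inj₂ decr
  where
  decr : Decreasing n (rotate n r w)
  decr s t s≤t t<n with r + s <? n
  ... | yes low rewrite rotate-low r w low | ≤-preserves-true (inc r (r + s) (m≤m+n r s) low) wr =
    Bool.≤-maximum _
  ... | no ¬low rewrite rotate-high r w (≮⇒≥ ¬low)
        | rotate-high r w (≤-trans (≮⇒≥ ¬low) (+-monoʳ-≤ r s≤t)) =
    not-anti (inc _ _ (∸-monoˡ-≤ n (+-monoʳ-≤ r s≤t))
      (m<n+o⇒m∸n<o (r + t) n {{>-nonZero (≤-<-trans z≤n t<n)}} (+-mono-≤-< r≤n t<n)))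
... | yes r<n | false = inj₁ incr
  where
  incr : Increasing n (rotate n r w)
  incr s t s≤t t<n with r + t <? n
  ... | yes low rewrite rotate-low r w low | rotate-low r w (≤-<-trans (+-monoʳ-≤ r s≤t) low) =
    inc _ _ (+-monoʳ-≤ r s≤t) low
  ... | no ¬low rewrite rotate-high r w (≮⇒≥ ¬low)
        | ≤-reflects-false (inc (r + t ∸ n) r (m≤n+o⇒m∸n≤o (r + t) n
            (subst (r + t ≤_) (+-comm r n) (+-monoʳ-≤ r (<⇒≤ t<n)))) r<n) wr =
    Bool.≤-maximum _

rotate-monotone : ∀ {n r w} → r ≤ n → Monotone n w → Monotone n (rotate n r w)
rotate-monotone r≤n (inj₁ inc) = rotate-increasing r≤n inc
rotate-monotone {n} {r} {w} r≤n (inj₂ dec) = Monotone-resp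
  (λ t _ → trans (cong not (rotate-not n r w t)) (Bool.not-involutive _))
  (Monotone-not (rotate-increasing r≤n λ s t s≤t t<n → not-anti (dec s t s≤t t<n)))

-- Rotations by `r` and `n ∸ r` make a full turn, which negates every letter; the outer `not` undoes
-- this.
unrotate : ℕ → ℕ → Word → Word
unrotate n r w = not ∘ rotate n (n ∸ r) w

rotate-unrotate : ∀ {n r} w → r ≤ n → ∀ t → t < n → rotate n r (unrotate n r w) t ≡ w t
rotate-unrotate {n} {r} w r≤n t t<n with r + t <? n
... | yes low = trans (rotate-low r (unrotate n r w) low) (trans (cong not (rotate-high (n ∸ r) w
      (subst (n ≤_) (sym back) (m≤m+n n t)))) (trans (Bool.not-involutive _) (cong w
      (trans (cong (_∸ n) back) (m+n∸m≡n n t)))))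
  where
  back : (n ∸ r) + (r + t) ≡ n + t
  back = trans (sym (+-assoc (n ∸ r) r t)) (cong (_+ t) (m∸n+n≡m r≤n))
... | no ¬low = trans (rotate-high r (unrotate n r w) (≮⇒≥ ¬low)) (trans (Bool.not-involutive _)
      (trans (rotate-low (n ∸ r) w (subst (_< n) (sym back) t<n)) (cong w back)))
  where
  open ≡-Reasoning
  back : (n ∸ r) + (r + t ∸ n) ≡ t
  back = begin
    (n ∸ r) + (r + t ∸ n)  ≡⟨ sym (+-∸-assoc (n ∸ r) (≮⇒≥ ¬low)) ⟩
    (n ∸ r) + (r + t) ∸ n  ≡⟨ cong (_∸ n) (sym (+-assoc (n ∸ r) r t)) ⟩
    (n ∸ r) + r + t ∸ n    ≡⟨ cong (λ m → m + t ∸ n) (m∸n+n≡m r≤n) ⟩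
    n + t ∸ n              ≡⟨ m+n∸m≡n n t ⟩
    t                      ∎

unrotate-rotate : ∀ {n r} w → r ≤ n → ∀ t → t < n → unrotate n r (rotate n r w) t ≡ w t
unrotate-rotate {n} {r} w r≤n t t<n = trans (sym (rotate-not n (n ∸ r) (rotate n r w) t))
  -- Because `n ∸ (n ∸ r) = r`, this is `rotate-unrotate` for the shift `n ∸ r`.
  (subst (λ r′ → rotate n (n ∸ r) (not ∘ rotate n r′ w) t ≡ w t) (m∸[m∸n]≡n r≤n)
    (rotate-unrotate w (m∸n≤m n r) t t<n))

unrotate-monotone : ∀ {n r w} → Monotone n w → Monotone n (unrotate n r w)
unrotate-monotone {n} {r} mon = Monotone-not (rotate-monotone (m∸n≤m n r) mon)

rotate-cong : ∀ {n r v w} → r ≤ n → (∀ t → t < n → v t ≡ w t) →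
  ∀ t → t < n → rotate n r v t ≡ rotate n r w t
rotate-cong {n} {r} r≤n v≗w t t<n = cong (twist n (r + t)) (v≗w _ (wrap< r≤n t<n))

unrotate-cong : ∀ {n r v w} → (∀ t → t < n → v t ≡ w t) →
  ∀ t → t < n → unrotate n r v t ≡ unrotate n r w t
unrotate-cong {n} {r} v≗w t t<n = cong not (rotate-cong (m∸n≤m n r) v≗w t t<n)

-- Words on `Fin n` as words on the natural numbers.

extend : ∀ {n} → (Fin n → Bool) → Word
extend {n} w t with t <? n
... | yes t<n = w (fromℕ< t<n)
... | no  _   = false

extend-fromℕ< : ∀ {n} (w : Fin n → Bool) {t} (t<n : t < n) → extend w t ≡ w (fromℕ< t<n)
extend-fromℕ< {n} w {t} t<n with t <? n
... | yes _   = refl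
... | no  t≮n = contradiction t<n t≮n

extend-toℕ : ∀ {n} (w : Fin n → Bool) i → extend w (toℕ i) ≡ w i
extend-toℕ w i = trans (extend-fromℕ< w (toℕ<n i)) (cong w (fromℕ<-toℕ i (toℕ<n i)))

Mon⇒Monotone : ∀ {n} {w : Fin n → Bool} → Mon n w → Monotone n (extend w)
Mon⇒Monotone {n} {w} (inj₁ inc) = inj₁ λ s t s≤t t<n → let s<n = ≤-<-trans s≤t t<n in
  subst₂ B._≤_ (sym (extend-fromℕ< w s<n)) (sym (extend-fromℕ< w t<n))
    (inc _ _ (subst₂ _≤_ (sym (toℕ-fromℕ< s<n)) (sym (toℕ-fromℕ< t<n)) s≤t))
Mon⇒Monotone {n} {w} (inj₂ dec) = inj₂ λ s t s≤t t<n → let s<n = ≤-<-trans s≤t t<n in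
  subst₂ B._≤_ (sym (extend-fromℕ< w t<n)) (sym (extend-fromℕ< w s<n))
    (dec _ _ (subst₂ _≤_ (sym (toℕ-fromℕ< s<n)) (sym (toℕ-fromℕ< t<n)) s≤t))

Monotone⇒Mon : ∀ {n} {v : Word} → Monotone n v → Mon n (v ∘ toℕ)
Monotone⇒Mon (inj₁ inc) = inj₁ λ i j i≤j → inc _ _ i≤j (toℕ<n j)
Monotone⇒Mon (inj₂ dec) = inj₂ λ i j i≤j → dec _ _ i≤j (toℕ<n j)

-- Residues, cyclic positions and intervals.

module Residues (k : ℕ) where
  private n = suc k

  modN< : ∀ z → modN z n < n
  modN< z = n%ℕd<d z n

  modN-division : ∀ z → ∃ λ q → z ≡ + modN z n Z.+ q Z.* + n
  modN-division z = z /ℕ n , a≡a%ℕn+[a/ℕn]*n z n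

  private
    -- A positive quotient would force `s ≥ n`, a negative one `t ≥ n`.
    residue-unique : ∀ {s t} → s < n → t < n → ∀ q → + s ≡ + t Z.+ q Z.* + n → s ≡ t
    residue-unique {s} {t} s<n t<n (+ q) eq = go q (Z.+-injective
        (trans eq (trans (cong (λ m → + t Z.+ m) (sym (Z.pos-* q n))) (sym (Z.pos-+ t (q * n))))))
      where
      go : ∀ q → s ≡ t + q * n → s ≡ t
      go zero    eq = trans eq (+-identityʳ t)
      go (suc q) eq = contradiction s<n (≤⇒≯ (subst (n ≤_) (sym eq)
        (≤-trans (m≤m+n n _) (m≤n+m _ t))))
    residue-unique {s} {t} s<n t<n (-[1+ q ]) eq = contradiction t<n (≤⇒≯ (subst (n ≤_)
        (Z.+-injective (trans (Z.pos-+ s (suc q * n))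
          (trans (cong₂ Z._+_ eq (Z.pos-* (suc q) n)) (cancel (+ t) (+ suc q) (+ n)))))
        (≤-trans (m≤m+n n _) (m≤n+m _ s))))
      where
      open +-*-Solver
      cancel : ∀ t q m → t Z.+ (Z.- q) Z.* m Z.+ q Z.* m ≡ t
      cancel = solve 3 (λ t q m → t :+ (:- q) :* m :+ q :* m := t) refl

  modN-unique : ∀ {z t} q → t < n → z ≡ + t Z.+ q Z.* + n → modN z n ≡ t
  modN-unique {z} {t} q t<n eq with modN-division z
  ... | q′ , eq′ = residue-unique (modN< z) t<n (q Z.- q′)
    (trans (isolate (+ modN z n) q′ (+ n)) (trans (cong (λ x → x Z.- q′ Z.* + n) (trans (sym eq′) eq))
      (collect (+ t) q q′ (+ n))))
    where
    open +-*-Solver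
    isolate : ∀ r q m → r ≡ r Z.+ q Z.* m Z.- q Z.* m
    isolate = solve 3 (λ r q m → r := r :+ q :* m :- q :* m) refl
    collect : ∀ t q q′ m → t Z.+ q Z.* m Z.- q′ Z.* m ≡ t Z.+ (q Z.- q′) Z.* m
    collect = solve 4 (λ t q q′ m → t :+ q :* m :- q′ :* m := t :+ (q :- q′) :* m) refl

  modN-wrap : ∀ s {t} → t < n → modN (+ wrap n (modN s n + t) - s) n ≡ t
  modN-wrap s {t} t<n with modN-division s | modN s n + t <? n
  ... | q , eq | yes low = modN-unique (Z.- q) t<n
    (trans (cong₂ (λ i z → + i Z.- z) (wrap-low low) eq) (shift (+ modN s n) (+ t) q (+ n)))
    where
    open +-*-Solver
    shift : ∀ r t q m → (r Z.+ t) Z.- (r Z.+ q Z.* m) ≡ t Z.+ (Z.- q) Z.* m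
    shift = solve 4 (λ r t q m → (r :+ t) :- (r :+ q :* m) := t :+ (:- q) :* m) refl
  ... | q , eq | no ¬low = modN-unique (Z.- + 1 Z.- q) t<n
    (trans (cong₂ (λ i z → i Z.- z) wrapped eq) (shift (+ modN s n) (+ t) q (+ n)))
    where
    open +-*-Solver
    shift : ∀ r t q m → (r Z.+ t Z.- m) Z.- (r Z.+ q Z.* m) ≡ t Z.+ (Z.- + 1 Z.- q) Z.* m
    shift = solve 4 (λ r t q m → (r :+ t :- m) :- (r :+ q :* m) := t :+ (:- con (+ 1) :- q) :* m) refl
    wrapped : + wrap n (modN s n + t) ≡ + modN s n Z.+ + t Z.- + n
    wrapped = trans (cong +_ (wrap-high (≮⇒≥ ¬low)))
      (trans (sym (Z.⊖-≥ (≮⇒≥ ¬low))) (sym (Z.m-n≡m⊖n (modN s n + t) n)))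

  private
    -- Shifts by `n ∸ r` and `r` add up to one full turn, and exactly one of the two wraps.
    wrap-involutive : ∀ {r} → r ≤ n → ∀ {c} → c < n → wrap n (r + wrap n (n ∸ r + c)) ≡ c
    wrap-involutive {r} r≤n {c} c<n with n ∸ r + c <? n
    ... | yes low = begin
      wrap n (r + wrap n (n ∸ r + c))  ≡⟨ cong (λ m → wrap n (r + m)) (wrap-low low) ⟩
      wrap n (r + (n ∸ r + c))         ≡⟨ cong (wrap n) (sym (+-assoc r (n ∸ r) c)) ⟩
      wrap n (r + (n ∸ r) + c)         ≡⟨ cong (λ m → wrap n (m + c)) (m+[n∸m]≡n r≤n) ⟩
      wrap n (n + c)                   ≡⟨ wrap-high (m≤m+n n c) ⟩
      n + c ∸ n                        ≡⟨ m+n∸m≡n n c ⟩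
      c                                ∎
      where open ≡-Reasoning
    ... | no ¬low = begin
      wrap n (r + wrap n (n ∸ r + c))  ≡⟨ cong (λ m → wrap n (r + m)) (wrap-high (≮⇒≥ ¬low)) ⟩
      wrap n (r + (n ∸ r + c ∸ n))     ≡⟨ cong (wrap n) (sym (+-∸-assoc r (≮⇒≥ ¬low))) ⟩
      wrap n (r + (n ∸ r + c) ∸ n)     ≡⟨ cong (λ m → wrap n (m ∸ n)) (sym (+-assoc r (n ∸ r) c)) ⟩
      wrap n (r + (n ∸ r) + c ∸ n)     ≡⟨ cong (λ m → wrap n (m + c ∸ n)) (m+[n∸m]≡n r≤n) ⟩
      wrap n (n + c ∸ n)               ≡⟨ cong (wrap n) (m+n∸m≡n n c) ⟩
      wrap n c                         ≡⟨ wrap-low c<n ⟩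
      c                                ∎
      where open ≡-Reasoning

  modN-unwrap : ∀ s {c} → c < n → modN (+ c - s) n ≡ wrap n (n ∸ modN s n + c)
  modN-unwrap s {c} c<n = trans
    (cong (λ c → modN (+ c - s) n) (sym (wrap-involutive (<⇒≤ (modN< s)) c<n)))
    (modN-wrap s (wrap< (m∸n≤m n (modN s n)) c<n))

  wrap-modN : ∀ s {c} → c < n → wrap n (modN s n + modN (+ c - s) n) ≡ c
  wrap-modN s c<n = trans (cong (λ t → wrap n (modN s n + t)) (modN-unwrap s c<n))
    (wrap-involutive (<⇒≤ (modN< s)) c<n)

  modN-periodic : ∀ {y} z q → y ≡ z Z.+ q Z.* + n → modN y n ≡ modN z n
  modN-periodic z q y≡ with modN-division z
  ... | q′ , z≡ = modN-unique (q′ Z.+ q) (modN< z)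
    (trans y≡ (trans (cong (Z._+ q Z.* + n) z≡) (collect (+ modN z n) q′ q (+ n))))
    where
    open +-*-Solver
    collect : ∀ t q′ q m → t Z.+ q′ Z.* m Z.+ q Z.* m ≡ t Z.+ (q′ Z.+ q) Z.* m
    collect = solve 4 (λ t q′ q m → t :+ q′ :* m :+ q :* m := t :+ (q′ :+ q) :* m) refl

  Outside : ℕ → ℕ → ℕ → Set
  Outside u v t = t < u ⊎ v ≤ t

  -- `d` and `e` lie `u` and `v` steps after `s`, up to `k₁` and `k₂` full turns, so the interval
  -- from `e` to `d - 1` is the complement of the half-open arc from `u` to `v` in offsets from `s`.
  -- The bound `v<n+u` makes the interval nonempty and the truncated subtraction exact.
  module Interval {s d e : ℤ} {u v : ℕ} (k₁ k₂ : ℤ)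
    (d≡ : d ≡ s Z.+ + u Z.+ k₁ Z.* + n) (e≡ : e ≡ s Z.+ + v Z.+ k₂ Z.* + n)
    (u<v : u < v) (v≤n : v ≤ n) (v<n+u : v < n + u) (c : Fin n) where

    private
      t = modN (+ toℕ c - s) n
      open +-*-Solver

      length : modN (d - + 1 - e) n ≡ n + u ∸ suc v
      length = modN-unique (k₁ Z.- k₂ Z.- + 1) (m<n+o⇒m∸n<o (n + u) (suc v) lt)
        (trans (cong₂ (λ x y → x - + 1 - y) d≡ e≡) (trans
          (arrange s (+ u) (+ v) k₁ k₂ (+ n))
          (cong (λ x → x Z.+ (k₁ Z.- k₂ Z.- + 1) Z.* + n) (sym size))))
        where
        lt : n + u < suc v + n
        lt = subst (n + u <_) (+-comm n (suc v)) (+-monoʳ-< n (m<n⇒m<1+n u<v))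
        size : + (n + u ∸ suc v) ≡ + n Z.+ + u Z.- (+ 1 Z.+ + v)
        size = trans (sym (Z.⊖-≥ v<n+u)) (sym (Z.m-n≡m⊖n (n + u) (suc v)))
        arrange : ∀ s u v k₁ k₂ m → s Z.+ u Z.+ k₁ Z.* m - + 1 - (s Z.+ v Z.+ k₂ Z.* m)
          ≡ m Z.+ u Z.- (+ 1 Z.+ v) Z.+ (k₁ Z.- k₂ Z.- + 1) Z.* m
        arrange = solve 6 (λ s u v k₁ k₂ m →
          s :+ u :+ k₁ :* m :- con (+ 1) :- (s :+ v :+ k₂ :* m) :=
          m :+ u :- (con (+ 1) :+ v) :+ (k₁ :- k₂ :- con (+ 1)) :* m) refl

      shift : ∀ {w} j → + t ≡ + w Z.+ + v Z.+ j Z.* + n → w < n → modN (+ toℕ c - e) n ≡ w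
      shift {w} j t≡ w<n with modN-division (+ toℕ c - s)
      ... | q , eq = modN-unique (j Z.+ q Z.- k₂) w<n
        (trans (cong (+ toℕ c -_) e≡) (trans (split (+ toℕ c) s (+ v) k₂ (+ n))
          (trans (cong (λ z → z - + v - k₂ Z.* + n) eq)
            (trans (cong (λ z → z Z.+ q Z.* + n - + v - k₂ Z.* + n) t≡)
              (arrange (+ w) (+ v) j q k₂ (+ n))))))
        where
        split : ∀ c s v k m → c - (s Z.+ v Z.+ k Z.* m) ≡ c - s - v - k Z.* m
        split = solve 5 (λ c s v k m → c :- (s :+ v :+ k :* m) := c :- s :- v :- k :* m) refl
        arrange : ∀ w v j q k m → w Z.+ v Z.+ j Z.* m Z.+ q Z.* m - v - k Z.* m
          ≡ w Z.+ (j Z.+ q - k) Z.* m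
        arrange = solve 6 (λ w v j q k m → w :+ v :+ j :* m :+ q :* m :- v :- k :* m
          := w :+ (j :+ q :- k) :* m) refl

      offset-high : v ≤ t → modN (+ toℕ c - e) n ≡ t ∸ v
      offset-high v≤t = shift (+ 0)
        (trans (cong +_ (sym (m∸n+n≡m v≤t))) (sym (Z.+-identityʳ _)))
        (≤-<-trans (m∸n≤m t v) (modN< (+ toℕ c - s)))

      offset-low : t < v → modN (+ toℕ c - e) n ≡ n ∸ v + t
      offset-low t<v = shift (Z.- + 1) t≡
        (<-≤-trans (+-monoʳ-< (n ∸ v) t<v) (≤-reflexive (m∸n+n≡m v≤n)))
        where
        arrange : ∀ m v t → t ≡ (m Z.- v) Z.+ t Z.+ v Z.+ (Z.- + 1) Z.* m
        arrange = solve 3 (λ m v t → t := (m :- v) :+ t :+ v :+ (:- con (+ 1)) :* m) refl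
        t≡ : + t ≡ + (n ∸ v + t) Z.+ + v Z.+ (Z.- + 1) Z.* + n
        t≡ = trans (arrange (+ n) (+ v) (+ t))
          (cong (λ x → x Z.+ + t Z.+ + v Z.+ (Z.- + 1) Z.* + n)
            (trans (Z.m-n≡m⊖n n v) (Z.⊖-≥ v≤n)))

      bound : n + u ∸ suc v ≡ n ∸ v + u ∸ 1
      bound = trans (sym (trans (∸-+-assoc (n + u) v 1) (cong (n + u ∸_) (+-comm v 1))))
        (cong (_∸ 1) (+-∸-comm u v≤n))

    interval⇒outside : InInterval n e (d - + 1) c → Outside u v t
    interval⇒outside c∈ with t <? v
    ... | no  t≮v = inj₂ (≮⇒≥ t≮v)
    ... | yes t<v = inj₁ (+-cancelˡ-< (n ∸ v) t u
      (strict (subst₂ _≤_ (offset-low t<v) (trans length bound) c∈)))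
      where
      -- Positivity makes the truncated `∸ 1` a true predecessor.
      pos : 0 < n ∸ v + u
      pos = subst (0 <_) (+-∸-comm u v≤n) (m<n⇒0<n∸m v<n+u)
      strict : ∀ {a} → a ≤ n ∸ v + u ∸ 1 → a < n ∸ v + u
      strict {a} le = subst (suc a ≤_) (m+[n∸m]≡n pos) (s≤s le)

    outside⇒interval : Outside u v t → InInterval n e (d - + 1) c
    outside⇒interval (inj₂ v≤t) = subst₂ _≤_ (sym (offset-high v≤t)) (sym length)
      (m+n≤o⇒m≤o∸n (t ∸ v) (subst (_≤ n + u) (sym (trans (+-suc (t ∸ v) v) (cong suc (m∸n+n≡m v≤t))))
        (≤-trans (modN< (+ toℕ c - s)) (m≤m+n n u))))
    outside⇒interval (inj₁ t<u) = subst₂ _≤_ (sym (offset-low (<-trans t<u u<v)))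
      (sym (trans length bound))
      (m+n≤o⇒m≤o∸n _ (subst (_≤ n ∸ v + u) (sym (trans (+-assoc (n ∸ v) t 1)
        (cong (λ x → n ∸ v + x) (+-comm t 1)))) (+-monoʳ-≤ (n ∸ v) t<u)))

-- Four coloured inputs that generate the monotone words.

cut-increasing : ∀ n {v} → Increasing n v → ∃ λ p → p ≤ n × (∀ t → t < n → v t ≡ not (t <ᵇ p))
cut-increasing zero inc = 0 , z≤n , λ _ ()
cut-increasing (suc n) {v} inc with v n in vn
... | false = suc n , ≤-refl , λ t t≤n → trans
  (≤-reflects-false (inc t n (≤-pred t≤n) ≤-refl) vn) (cong not (sym (dec-true (t <? suc n) t≤n)))
... | true with cut-increasing n (λ s t s≤t t<n → inc s t s≤t (m<n⇒m<1+n t<n))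
...   | p , p≤n , cut = p , m≤n⇒m≤1+n p≤n , below
  where
  below : ∀ t → t < suc n → v t ≡ not (t <ᵇ p)
  below t t≤n with m≤n⇒m<n∨m≡n (≤-pred t≤n)
  ... | inj₁ t<n = cut t t<n
  ... | inj₂ refl = trans vn (cong not (sym (dec-false (t <? p) (≤⇒≯ p≤n))))

cut-monotone : ∀ {n v} → Monotone n v →
  ∃₂ λ b p → p ≤ n × (∀ t → t < n → v t ≡ (if t <ᵇ p then b else not b))
cut-monotone {n} {v} (inj₁ inc) with cut-increasing n inc
... | p , p≤n , cut = false , p , p≤n , λ t t<n → trans (cut t t<n) (form (t <ᵇ p))
  where
  form : ∀ c → not c ≡ (if c then false else true)
  form true  = refl
  form false = refl
cut-monotone {n} {v} (inj₂ dec) with cut-increasing n (λ s t s≤t t<n → not-anti (dec s t s≤t t<n))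
... | p , p≤n , cut = true , p , p≤n , λ t t<n → trans (Bool.not-injective (cut t t<n)) (form (t <ᵇ p))
  where
  form : ∀ c → c ≡ (if c then true else false)
  form true  = refl
  form false = refl

Colour : Set
Colour = Fin 3

opposite : Colour → Colour
opposite 0F = 1F
opposite 1F = 0F
opposite 2F = 2F

-- This table was found by computer search; the conditions it has to meet are ends-ordered
-- and colours-change.
pair : Colour → Colour → Colour → Bool × Bool
pair 0F 0F _  = true  , true
pair 0F 1F 0F = true  , true
pair 0F 1F _  = false , false
pair 0F 2F 1F = true  , false
pair 0F 2F _  = true  , true
pair 1F 0F 1F = false , false
pair 1F 0F _  = true  , true
pair 1F 1F _  = false , false
pair 1F 2F 0F = false , true
pair 1F 2F _  = false , false
pair 2F 0F _  = true  , true
pair 2F 1F _  = false , false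
pair 2F 2F 0F = true  , true
pair 2F 2F _  = false , false

-- Colours that wrap around 0 enter through opposite, just as wrapped letters are negated.
ends : Fin 4 → Colour → Colour → Colour → Colour → Bool × Bool
ends 0F a b c d = pair b c d
ends 1F a b c d = pair c d (opposite a)
ends 2F a b c d = pair d (opposite a) (opposite b)
ends 3F a b c d = pair (opposite a) (opposite b) (opposite c)

-- The eight letters, read arc by arc, form a chain, so the word stays monotone wherever each arc
-- switches from its first to its second letter. A general relation serves both directions at once.
Ordered : Rel Bool _ → (Fin 4 → Bool × Bool) → Set
Ordered _≼_ e = ∀ i → proj₁ (e i) ≼ proj₂ (e i) × (∀ j → i Fin.< j → proj₂ (e i) ≼ proj₁ (e j))

ordered? : ∀ {_≼_ : Rel Bool _} → (∀ a b → Dec (a ≼ b)) → ∀ e → Dec (Ordered _≼_ e)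
ordered? _≼?_ e = all? λ i → (_ ≼? _) ×-dec (all? λ j → (i Fin.<? j) →-dec (_ ≼? _))

-- Decided by evaluation over all 81 colourings.
ends-ordered : ∀ a b c d →
  Ordered B._≤_ (λ k → ends k a b c d) ⊎ Ordered (flip B._≤_) (λ k → ends k a b c d)
ends-ordered = toWitness {a? = all? λ a → all? λ b → all? λ c → all? λ d →
  ordered? Bool._≤?_ (λ k → ends k a b c d) ⊎-dec
  ordered? (flip Bool._≤?_) (λ k → ends k a b c d)} _

colours : Fin 4 → Bool → Fin 4 → Colour
colours 0F false = λ { 0F → 0F ; 1F → 1F ; 2F → 2F ; 3F → 0F }
colours 0F true  = λ { 0F → 0F ; 1F → 0F ; 2F → 2F ; 3F → 1F }
colours 1F false = λ { 0F → 1F ; 1F → 0F ; 2F → 1F ; 3F → 2F }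
colours 1F true  = λ { 0F → 0F ; 1F → 0F ; 2F → 0F ; 3F → 2F }
colours 2F false = λ { 0F → 2F ; 1F → 1F ; 2F → 0F ; 3F → 1F }
colours 2F true  = λ { 0F → 2F ; 1F → 0F ; 2F → 0F ; 3F → 0F }
colours 3F false = λ { 0F → 0F ; 1F → 2F ; 2F → 1F ; 3F → 0F }
colours 3F true  = λ { 0F → 1F ; 1F → 2F ; 2F → 0F ; 3F → 0F }

endsOf : Fin 4 → (Fin 4 → Colour) → Bool × Bool
endsOf k c = ends k (c 0F) (c 1F) (c 2F) (c 3F)

-- With one common threshold in arc `k`, the letters before it read first components and the others
-- second components, so these values give a word that changes from `b` to `not b` exactly there.
colours-change : ∀ b k i → (i Fin.≤ k → proj₁ (endsOf i (colours k b)) ≡ b)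
                         × (k Fin.≤ i → proj₂ (endsOf i (colours k b)) ≡ not b)
colours-change false = toWitness {a? = all? λ k → all? λ i →
  ((i Fin.≤? k) →-dec (_ Bool.≟ _)) ×-dec ((k Fin.≤? i) →-dec (_ Bool.≟ _))} _
colours-change true = toWitness {a? = all? λ k → all? λ i →
  ((i Fin.≤? k) →-dec (_ Bool.≟ _)) ×-dec ((k Fin.≤? i) →-dec (_ Bool.≟ _))} _

endsOf-local : ∀ k c c′ → (∀ j → j ≢ k → c j ≡ c′ j) → endsOf k c ≡ endsOf k c′
endsOf-local 0F c c′ eq rewrite eq 1F (λ ()) | eq 2F (λ ()) | eq 3F (λ ()) = refl
endsOf-local 1F c c′ eq rewrite eq 0F (λ ()) | eq 2F (λ ()) | eq 3F (λ ()) = refl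
endsOf-local 2F c c′ eq rewrite eq 0F (λ ()) | eq 1F (λ ()) | eq 3F (λ ()) = refl
endsOf-local 3F c c′ eq rewrite eq 0F (λ ()) | eq 1F (λ ()) | eq 2F (λ ()) = refl

-- The change inside arc `k` is placed by the threshold of input `next k`, because input `k` must
-- stay invisible to arc `k`.
next : Fin 4 → Fin 4
next 0F = 1F
next 1F = 2F
next 2F = 3F
next 3F = 0F

next≢ : ∀ k → next k ≢ k
next≢ 0F ()
next≢ 1F ()
next≢ 2F ()
next≢ 3F ()

module Generator (e₁ e₂ e₃ n : ℕ) (e₁≤e₂ : e₁ ≤ e₂) (e₂≤e₃ : e₂ ≤ e₃) where

  start end : Fin 4 → ℕ
  start 0F = 0
  start 1F = e₁
  start 2F = e₂
  start 3F = e₃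
  end 0F = e₁
  end 1F = e₂
  end 2F = e₃
  end 3F = n

  arc : ℕ → Fin 4
  arc t with t <? e₁ | t <? e₂ | t <? e₃
  ... | yes _ | _     | _     = 0F
  ... | no _  | yes _ | _     = 1F
  ... | no _  | no _  | yes _ = 2F
  ... | no _  | no _  | no _  = 3F

  start-arc : ∀ t → start (arc t) ≤ t
  start-arc t with t <? e₁ | t <? e₂ | t <? e₃
  ... | yes _   | _       | _       = z≤n
  ... | no t≮e₁ | yes _   | _       = ≮⇒≥ t≮e₁
  ... | no _    | no t≮e₂ | yes _   = ≮⇒≥ t≮e₂
  ... | no _    | no _    | no t≮e₃ = ≮⇒≥ t≮e₃

  end≤start : ∀ i j → i Fin.< j → end i ≤ start j
  end≤start 0F 1F _ = ≤-refl
  end≤start 0F 2F _ = e₁≤e₂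
  end≤start 0F 3F _ = ≤-trans e₁≤e₂ e₂≤e₃
  end≤start 1F 2F _ = ≤-refl
  end≤start 1F 3F _ = e₂≤e₃
  end≤start 2F 3F _ = ≤-refl
  end≤start 1F 1F (s≤s ())
  end≤start 2F 1F (s≤s ())
  end≤start 2F 2F (s≤s (s≤s ()))
  end≤start 3F 1F (s≤s ())
  end≤start 3F 2F (s≤s (s≤s ()))
  end≤start 3F 3F (s≤s (s≤s (s≤s ())))

  before-start : ∀ t j → arc t Fin.< j → t < start j
  before-start t j arc<j with t <? e₁ | t <? e₂ | t <? e₃
  ... | yes t<e₁ | _        | _        = <-≤-trans t<e₁ (end≤start 0F j arc<j)
  ... | no _     | yes t<e₂ | _        = <-≤-trans t<e₂ (end≤start 1F j arc<j)
  ... | no _     | no _     | yes t<e₃ = <-≤-trans t<e₃ (end≤start 2F j arc<j)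
  before-start t 0F () | no _ | no _ | no _
  before-start t 1F (s≤s ()) | no _ | no _ | no _
  before-start t 2F (s≤s (s≤s ())) | no _ | no _ | no _
  before-start t 3F (s≤s (s≤s (s≤s ()))) | no _ | no _ | no _

  arc-monotone : ∀ {s t} → s ≤ t → arc s Fin.≤ arc t
  arc-monotone {s} {t} s≤t = ≮⇒≥ λ arc< →
    <⇒≱ (<-≤-trans (before-start t (arc s) arc<) (start-arc s)) s≤t

  off-arc : ∀ t j → j ≢ arc t → t < start j ⊎ end j ≤ t
  off-arc t j j≢ with <-cmpᶠ j (arc t)
  ... | tri< j< _ _ = inj₂ (≤-trans (end≤start j (arc t) j<) (start-arc t))
  ... | tri≈ _ j≡ _ = contradiction j≡ j≢
  ... | tri> _ _ j> = inj₁ (before-start t j j>)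

  -- A threshold is an absolute position; one that falls outside its arc gives this arc a single
  -- letter.
  fill : (Fin 4 → Bool × Bool) → (Fin 4 → ℕ) → Word
  fill e τ t = if t <ᵇ τ (arc t) then proj₁ (e (arc t)) else proj₂ (e (arc t))

  -- Across arcs, pass through the second letter of the left arc and the first letter of the right
  -- one. Within an arc, the only switch is from the first letter to the second.
  fill-ordered : ∀ (_≼_ : Rel Bool _) → Reflexive _≼_ → Transitive _≼_ →
    ∀ {e} τ → Ordered _≼_ e → ∀ {s t} → s ≤ t → fill e τ s ≼ fill e τ t
  fill-ordered _≼_ ≼-refl ≼-trans {e} τ ord {s} {t} s≤t with <-cmpᶠ (arc s) (arc t)
  ... | tri> _ _ arc> = contradiction (arc-monotone s≤t) (<⇒≱ arc>)
  ... | tri< arc< _ _ = ≼-trans (upper (s <ᵇ τ (arc s)))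
      (≼-trans (proj₂ (ord (arc s)) (arc t) arc<) (lower (t <ᵇ τ (arc t))))
    where
    upper : ∀ b → (if b then proj₁ (e (arc s)) else proj₂ (e (arc s))) ≼ proj₂ (e (arc s))
    upper true  = proj₁ (ord (arc s))
    upper false = ≼-refl
    lower : ∀ b → proj₁ (e (arc t)) ≼ (if b then proj₁ (e (arc t)) else proj₂ (e (arc t)))
    lower true  = ≼-refl
    lower false = proj₁ (ord (arc t))
  ... | tri≈ _ arc≡ _ rewrite arc≡ with s <? τ (arc t) | t <? τ (arc t)
  ...   | yes s<τ | yes t<τ
    rewrite dec-true (s <? τ (arc t)) s<τ | dec-true (t <? τ (arc t)) t<τ = ≼-refl
  ...   | yes s<τ | no  t≮τ
    rewrite dec-true (s <? τ (arc t)) s<τ | dec-false (t <? τ (arc t)) t≮τ = proj₁ (ord (arc t))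
  ...   | no  s≮τ | no  t≮τ
    rewrite dec-false (s <? τ (arc t)) s≮τ | dec-false (t <? τ (arc t)) t≮τ = ≼-refl
  ...   | no  s≮τ | yes t<τ = contradiction (≤-<-trans s≤t t<τ) s≮τ

  generate : (Fin 4 → Colour × ℕ) → Word
  generate x = fill (λ k → endsOf k (proj₁ ∘ x)) (λ k → proj₂ (x (next k)))

  generate-monotone : ∀ x → Monotone n (generate x)
  generate-monotone x = Sum.map
    (λ ord s t s≤t _ → fill-ordered B._≤_ Bool.≤-refl Bool.≤-trans cuts ord s≤t)
    (λ ord s t s≤t _ → fill-ordered (flip B._≤_) Bool.≤-refl (flip Bool.≤-trans) cuts ord s≤t)
    (ends-ordered (proj₁ (x 0F)) (proj₁ (x 1F)) (proj₁ (x 2F)) (proj₁ (x 3F)))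
    where
    cuts : Fin 4 → ℕ
    cuts k = proj₂ (x (next k))

  generate-local : ∀ x y t → (∀ j → j ≢ arc t → x j ≡ y j) → generate x t ≡ generate y t
  generate-local x y t agree = cong₂ (λ p e → if t <ᵇ p then proj₁ e else proj₂ e)
    (cong proj₂ (agree (next (arc t)) (next≢ (arc t))))
    (endsOf-local (arc t) (proj₁ ∘ x) (proj₁ ∘ y) (λ j j≢ → cong proj₁ (agree j j≢)))

  generate-surjective : ∀ {v} → Monotone n v →
    ∃₂ λ c p → p ≤ n × (∀ t → t < n → generate (λ j → c j , p) t ≡ v t)
  generate-surjective {v} mon with cut-monotone mon
  ... | b , p , p≤n , v-cut =
    c , p , p≤n , λ t t<n → trans (correct t) (sym (v-cut t t<n))
    where
    c : Fin 4 → Colour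
    -- Positions before `p` lie in arcs up to `arc p`, the others in arcs from `arc p` on; this also
    -- covers `p = n`.
    c = colours (arc p) b
    correct : ∀ t → generate (λ j → c j , p) t ≡ (if t <ᵇ p then b else not b)
    correct t with t <? p
    ... | yes t<p rewrite dec-true (t <? p) t<p =
      proj₁ (colours-change b (arc p) (arc t)) (arc-monotone (<⇒≤ t<p))
    ... | no  t≮p rewrite dec-false (t <? p) t≮p =
      proj₂ (colours-change b (arc p) (arc t)) (arc-monotone (≮⇒≥ t≮p))

-- From the cyclic parameters to linear offsets.

record Separated (n : ℕ) (a₀ a₁ a₂ a₃ : ℤ) : Set where
  constructor separated
  field
    gap₁ : + 2 Z.≤ a₁ - a₀
    gap₂ : + 2 Z.≤ a₂ - a₁
    gap₃ : + 2 Z.≤ a₃ - a₂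
    span : a₃ - a₀ Z.≤ + n - + 2

-- Distances from `a₀` as natural numbers. The bound on the span becomes `2+e₃≤n`: the arc that
-- closes the circle also has at least two positions.
record Offsets (n : ℕ) (a₀ a₁ a₂ a₃ : ℤ) : Set where
  field
    e₁ e₂ e₃ : ℕ
    a₁≡ : a₁ ≡ a₀ Z.+ + e₁
    a₂≡ : a₂ ≡ a₀ Z.+ + e₂
    a₃≡ : a₃ ≡ a₀ Z.+ + e₃
    2≤e₁ : 2 ≤ e₁
    2+e₁≤e₂ : 2 + e₁ ≤ e₂
    2+e₂≤e₃ : 2 + e₂ ≤ e₃
    2+e₃≤n : 2 + e₃ ≤ n

offsets : ∀ {n a₀ a₁ a₂ a₃} → Separated n a₀ a₁ a₂ a₃ → Offsets n a₀ a₁ a₂ a₃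
offsets {n} {a₀} {a₁} {a₂} {a₃} (separated g₁ g₂ g₃ g₄)
  with a₁ - a₀ in eq₁ | a₂ - a₁ in eq₂ | a₃ - a₂ in eq₃ | g₁ | g₂ | g₃
-- Differences of at least 2 are nonnegative, so no other patterns remain.
... | + d₁ | + d₂ | + d₃ | +≤+ h₁ | +≤+ h₂ | +≤+ h₃ = record
  { e₁ = d₁ ; e₂ = d₂ + d₁ ; e₃ = d₃ + (d₂ + d₁)
  ; a₁≡ = a₁≡ ; a₂≡ = a₂≡ ; a₃≡ = a₃≡
  ; 2≤e₁ = h₁ ; 2+e₁≤e₂ = +-monoˡ-≤ d₁ h₂ ; 2+e₂≤e₃ = +-monoˡ-≤ (d₂ + d₁) h₃
  ; 2+e₃≤n = Z.drop‿+≤+ (subst₂ Z._≤_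
      (cong (λ x → + 2 Z.+ x) (trans (cong (_- a₀) a₃≡) (back a₀ _)))
      (cancel (+ n)) (Z.+-monoʳ-≤ (+ 2) g₄))
  }
  where
  open +-*-Solver
  forth : ∀ a b → b ≡ a Z.+ (b - a)
  forth = solve 2 (λ a b → b := a :+ (b :- a)) refl
  back : ∀ a x → a Z.+ x - a ≡ x
  back = solve 2 (λ a x → a :+ x :- a := x) refl
  swap : ∀ a x y → a Z.+ x Z.+ y ≡ a Z.+ (y Z.+ x)
  swap = solve 3 (λ a x y → a :+ x :+ y := a :+ (y :+ x)) refl
  cancel : ∀ m → + 2 Z.+ (m - + 2) ≡ m
  cancel = solve 1 (λ m → con (+ 2) :+ (m :- con (+ 2)) := m) refl
  a₁≡ : a₁ ≡ a₀ Z.+ + d₁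
  a₁≡ = trans (forth a₀ a₁) (cong (λ d → a₀ Z.+ d) eq₁)
  a₂≡ : a₂ ≡ a₀ Z.+ + (d₂ + d₁)
  a₂≡ = trans (forth a₁ a₂) (trans (cong₂ Z._+_ a₁≡ eq₂) (swap a₀ (+ d₁) (+ d₂)))
  a₃≡ : a₃ ≡ a₀ Z.+ + (d₃ + (d₂ + d₁))
  a₃≡ = trans (forth a₂ a₃) (trans (cong₂ Z._+_ a₂≡ eq₃) (swap a₀ (+ (d₂ + d₁)) (+ d₃)))

-- Generation and minimality on the circle.

module Complex (k : ℕ) {a₀ a₁ a₂ a₃ : ℤ} (sep : Separated (suc k) a₀ a₁ a₂ a₃) where

  private
    n = suc k
  open Offsets (offsets sep)
  open Residues k

  private
    e₁<e₂ : e₁ < e₂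
    e₁<e₂ = ≤-trans (n≤1+n _) 2+e₁≤e₂
    e₂<e₃ : e₂ < e₃
    e₂<e₃ = ≤-trans (n≤1+n _) 2+e₂≤e₃
    e₃<n : e₃ < n
    e₃<n = ≤-trans (n≤1+n _) 2+e₃≤n
    0<e₁ : 0 < e₁
    0<e₁ = ≤-trans (s≤s z≤n) 2≤e₁
    e₂<n = <-trans e₂<e₃ e₃<n
    e₁<n = <-trans e₁<e₂ e₂<n

  open Generator e₁ e₂ e₃ n (<⇒≤ e₁<e₂) (<⇒≤ e₂<e₃)

  shift : ℕ
  shift = modN a₀ n

  shift≤n : shift ≤ n
  shift≤n = <⇒≤ (modN< a₀)

  -- The place of position `i` in the word read from `a₀` on.
  offset : Fin n → ℕ
  offset i = modN (+ toℕ i - a₀) n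

  private
    plain : ∀ {a} e → a ≡ a₀ Z.+ + e → a ≡ a₀ Z.+ + e Z.+ + 0 Z.* + n
    plain e eq = trans eq (sym (Z.+-identityʳ _))

    wrapped : a₀ ≡ a₀ Z.+ + n Z.+ (Z.- + 1) Z.* + n
    wrapped = lemma a₀ (+ n)
      where
      open +-*-Solver
      lemma : ∀ a m → a ≡ a Z.+ m Z.+ (Z.- + 1) Z.* m
      lemma = solve 2 (λ a m → a := a :+ m :+ (:- con (+ 1)) :* m) refl

    a₀≡ : a₀ ≡ a₀ Z.+ + 0
    a₀≡ = sym (Z.+-identityʳ a₀)

    module I₀ = Interval {s = a₀} (+ 0) (+ 0) (plain 0 a₀≡) (plain e₁ a₁≡)
      0<e₁ (<⇒≤ e₁<n) (≤-trans e₁<n (m≤m+n n 0))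
    module I₁ = Interval {s = a₀} (+ 0) (+ 0) (plain e₁ a₁≡) (plain e₂ a₂≡)
      e₁<e₂ (<⇒≤ e₂<n) (≤-trans e₂<n (m≤m+n n e₁))
    module I₂ = Interval {s = a₀} (+ 0) (+ 0) (plain e₂ a₂≡) (plain e₃ a₃≡)
      e₂<e₃ (<⇒≤ e₃<n) (≤-trans e₃<n (m≤m+n n e₂))
    -- The last arc ends at offset `n`; `wrapped` writes its endpoint `a₀` as this offset and one
    -- turn back.
    module I₃ = Interval {s = a₀} (+ 0) (Z.- + 1) (plain e₃ a₃≡) wrapped e₃<n ≤-refl
      (m<m+n n (<-trans 0<e₁ (<-trans e₁<e₂ e₂<e₃)))

  Avoids : Subset n → Fin 4 → Set
  Avoids S j = ∀ i → i ∈ S → Outside (start j) (end j) (offset i)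

  -- The facets, in the listed order, are the complements of the arcs 2, 1, 0 and 3.
  K4⇒avoids : ∀ {S} → K4 n a₀ a₁ a₂ a₃ S → ∃ (Avoids S)
  K4⇒avoids (inj₁ S⊆)               = 2F , λ i i∈S → I₂.interval⇒outside i (S⊆ i i∈S)
  K4⇒avoids (inj₂ (inj₁ S⊆))        = 1F , λ i i∈S → I₁.interval⇒outside i (S⊆ i i∈S)
  K4⇒avoids (inj₂ (inj₂ (inj₁ S⊆))) = 0F , λ i i∈S → I₀.interval⇒outside i (S⊆ i i∈S)
  K4⇒avoids (inj₂ (inj₂ (inj₂ S⊆))) = 3F , λ i i∈S → I₃.interval⇒outside i (S⊆ i i∈S)

  avoids⇒K4 : ∀ {S} j → Avoids S j → K4 n a₀ a₁ a₂ a₃ S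
  avoids⇒K4 2F out = inj₁ λ i i∈S → I₂.outside⇒interval i (out i i∈S)
  avoids⇒K4 1F out = inj₂ (inj₁ λ i i∈S → I₁.outside⇒interval i (out i i∈S))
  avoids⇒K4 0F out = inj₂ (inj₂ (inj₁ λ i i∈S → I₀.outside⇒interval i (out i i∈S)))
  avoids⇒K4 3F out = inj₂ (inj₂ (inj₂ λ i i∈S → I₃.outside⇒interval i (out i i∈S)))

  private
    decode : Fin (3 * suc n) → Colour × ℕ
    decode = map₂ toℕ ∘ remQuot (suc n)

    generator : Fn (3 * suc n) 4 n
    generator x = unrotate n shift (generate (decode ∘ x)) ∘ toℕ

    allButOwn : Fin n → Subset 4
    allButOwn i = ∁ ⁅ arc (offset i) ⁆

    generator-local : ∀ i → Determines generator i (allButOwn i)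
    generator-local i x y agree = cong (not ∘ twist n (n ∸ shift + toℕ i))
      (generate-local (decode ∘ x) (decode ∘ y) _ λ j j≢ →
        cong decode (agree j (x∉p⇒x∈∁p (x≢y⇒x∉⁅y⁆ (subst (λ t → j ≢ arc t)
          (sym (modN-unwrap a₀ (toℕ<n i))) j≢)))))

    generator-surjective : ∀ w → Mon n w → ∃ λ x → ∀ i → generator x i ≡ w i
    generator-surjective w mon
      with generate-surjective (rotate-monotone shift≤n (Mon⇒Monotone mon))
    ... | c , p , p≤n , generates = x , λ i →
      trans (unrotate-cong {r = shift} (λ t t<n → trans
              (generate-local (decode ∘ x) (λ j → c j , p) t (λ j _ → decode-x j))
              (generates t t<n)) (toℕ i) (toℕ<n i))
        (trans (unrotate-rotate (extend w) shift≤n (toℕ i) (toℕ<n i)) (extend-toℕ w i))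
      where
      x : Fin 4 → Fin (3 * suc n)
      x j = combine (c j) (fromℕ< (s≤s p≤n))
      decode-x : ∀ j → decode (x j) ≡ (c j , p)
      decode-x j = trans (cong (map₂ toℕ) (remQuot-combine {3} (c j) (fromℕ< (s≤s p≤n))))
        (cong (c j ,_) (toℕ-fromℕ< (s≤s p≤n)))

  -- The window of `i` lies in `allButOwn i`. An input common to all windows over `S` is therefore
  -- not the own arc of any position in `S`, so `S` avoids that arc.
  K4-generates : Generates (K4 n a₀ a₁ a₂ a₃) (Mon n)
  K4-generates = _ , _ , generator ,
    (generator-surjective ,
     λ x → Monotone⇒Mon (unrotate-monotone {r = shift} {w = generate (decode ∘ x)}
       (generate-monotone (decode ∘ x)))) ,
    (λ i → proj₁ (win i)) , (λ i → proj₁ (proj₂ (win i))) ,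
    λ S (j , common) → avoids⇒K4 j λ i i∈S → off-arc (offset i) j λ j≡ →
      x∈∁p⇒x∉p (proj₂ (proj₂ (win i)) (common i i∈S)) (subst (λ l → j ∈ ⁅ l ⁆) j≡ (x∈⁅x⁆ j))
    where
    win : ∀ i → _
    win i = window generator i (allButOwn i) (generator-local i)

  offset-injective : ∀ {i j} → offset i ≡ offset j → i ≡ j
  offset-injective {i} {j} eq = toℕ-injective (trans (sym (wrap-modN a₀ (toℕ<n i)))
    (trans (cong (λ t → wrap n (shift + t)) eq) (wrap-modN a₀ (toℕ<n j))))

  open Obstruction e₁ e₂ e₃ k 0<e₁ 2+e₁≤e₂ 2+e₂≤e₃ (≤-pred 2+e₃≤n) using (Omits)

  outside⇒∉arc : ∀ {l r t} → Outside l r t → ¬ Arc l r t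
  outside⇒∉arc (inj₁ t<l) (l≤t , _) = <⇒≱ t<l l≤t
  outside⇒∉arc (inj₂ r≤t) (_ , t<r) = <⇒≱ t<r r≤t

  module _ (K : Family n) (complex : IsComplex K) (K⊑ : K ⊑ K4 n a₀ a₁ a₂ a₃)
    (S : Subset n) (S⊆ : S ⊆ᵢ InInterval n a₁ (a₀ - + 1)) (S∉K : ¬ K S) where

    -- A generating function, read from `a₀` on, meets the hypotheses of `obstruction`; surjectivity
    -- supplies preimages of the three step words.
    not-generating : ¬ Generates K (Mon n)
    not-generating (b , m , f , (surj , sound) , Win , isWin , comm) =
      Obstruction.obstruction e₁ e₂ e₃ k 0<e₁ 2+e₁≤e₂ 2+e₂≤e₃ (≤-pred 2+e₃≤n)
        (λ j → proj₁ (class j)) (λ j → proj₁ (proj₂ (class j)))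
        g (λ x → rotate-monotone shift≤n (Mon⇒Monotone (sound x))) reads
        (proj₁ (witness e₁ false)) (proj₁ (witness e₂ true)) (proj₁ (witness e₃ false))
        (proj₂ (witness e₁ false)) (proj₂ (witness e₂ true)) (proj₂ (witness e₃ false))
      where
      g : (Fin m → Fin b) → Word
      g x = rotate n shift (extend (f x))

      -- The largest set that `j` makes a simplex of the communication complex.
      influence : Fin m → Subset n
      influence j = tabulate λ i → lookup (Win i) j

      ∈influence⁻ : ∀ {i j} → i ∈ influence j → j ∈ Win i
      ∈influence⁻ {i} {j} i∈ = lookup⇒[]= j (Win i)
        (trans (sym (lookup∘tabulate (λ i → lookup (Win i) j) i)) ([]=⇒lookup i∈))

      ∈influence⁺ : ∀ {i j} → j ∈ Win i → i ∈ influence j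
      ∈influence⁺ {i} {j} j∈ = lookup⇒[]= i _
        (trans (lookup∘tabulate (λ i → lookup (Win i) j) i) ([]=⇒lookup j∈))

      influence∈K : ∀ j → K (influence j)
      influence∈K j = comm (influence j) (j , λ i → ∈influence⁻)

      -- Each influence set lies in `K` and so avoids an arc. If this arc is `A₀`, the set cannot
      -- contain `S`, as `K` is closed downwards, so it misses some position of `S`; that position
      -- lies beyond `A₀` because `S` avoids `A₀`.
      class : ∀ j → ∃ λ c → (∀ {t} → c ≡ omit₀ t → Arc e₁ n t) ×
                            (∀ i → j ∈ Win i → ¬ Omits c (offset i))
      class j with K4⇒avoids (K⊑ _ (influence∈K j))
      ... | 1F , out = omit₁ , (λ ()) , λ i j∈ → outside⇒∉arc (out i (∈influence⁺ j∈))
      ... | 2F , out = omit₂ , (λ ()) , λ i j∈ → outside⇒∉arc (out i (∈influence⁺ j∈))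
      ... | 3F , out = omit₃ , (λ ()) , λ i j∈ → outside⇒∉arc (out i (∈influence⁺ j∈))
      ... | 0F , out with ¬∀⟶∃¬ n (λ i → i ∈ S → i ∈ influence j)
                            (λ i → (i ∈? S) →-dec (i ∈? influence j))
                            (λ S⊆infl → S∉K (complex (influence j) S (λ {i} → S⊆infl i) (influence∈K j)))
      ...   | i , missed = omit₀ (offset i) , (λ { refl → bound }) , seen
        where
        i∈S : i ∈ S
        i∈S = decidable-stable (i ∈? S) λ i∉S → missed λ i∈S → contradiction i∈S i∉S
        bound : Arc e₁ n (offset i)
        bound with I₀.interval⇒outside i (S⊆ i i∈S)
        ... | inj₂ e₁≤ = e₁≤ , modN< (+ toℕ i - a₀)
        seen : ∀ i′ → j ∈ Win i′ → ¬ Omits (omit₀ (offset i)) (offset i′)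
        seen i′ j∈ (inj₁ <e₁) = outside⇒∉arc (out i′ (∈influence⁺ j∈)) (z≤n , <e₁)
        seen i′ j∈ (inj₂ eq) with offset-injective {i′} {i} eq
        ... | refl = missed λ _ → ∈influence⁺ j∈

      reads : ∀ t → t ≤ k → ∀ x x′ → (∀ j → ¬ Omits (proj₁ (class j)) t → x j ≡ x′ j) → g x t ≡ g x′ t
      reads t t≤k x x′ agree = cong (twist n (shift + t))
        (trans (extend-fromℕ< (f x) pos<n)
          (trans (proj₁ (isWin i) x x′ λ j j∈ → agree j
            (subst (¬_ ∘ Omits (proj₁ (class j))) offset-i (proj₂ (proj₂ (class j)) i j∈)))
            (sym (extend-fromℕ< (f x′) pos<n))))
        where
        pos<n : wrap n (shift + t) < n
        pos<n = wrap< shift≤n (s≤s t≤k)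
        i : Fin n
        i = fromℕ< pos<n
        offset-i : offset i ≡ t
        offset-i = trans (cong (λ c → modN (+ c - a₀) n) (toℕ-fromℕ< pos<n)) (modN-wrap a₀ (s≤s t≤k))

      witness : ∀ p c → ∃ λ x → ∀ t → t ≤ k → g x t ≡ step p c t
      witness p c with surj _ (Monotone⇒Mon (unrotate-monotone {r = shift} (step-monotone n p c)))
      ... | x , fx≗ = x , λ t t≤k → trans
        (rotate-cong shift≤n (λ s s<n → trans (extend-fromℕ< (f x) s<n)
          (trans (fx≗ _) (cong (unrotate n shift (step p c)) (toℕ-fromℕ< s<n)))) t (s≤s t≤k))
        (rotate-unrotate (step p c) shift≤n t (s≤s t≤k))

-- Rotating the four parameters to reach every facet.

separated-rotate : ∀ {n a₀ a₁ a₂ a₃} → Separated n a₀ a₁ a₂ a₃ → Separated n a₁ a₂ a₃ (a₀ Z.+ + n)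
separated-rotate {n} {a₀} {a₁} {a₂} {a₃} (separated g₁ g₂ g₃ g₄) = separated g₂ g₃
  -- The old span bounds the new last gap `a₀ + n - a₃`, and the old first gap bounds the new span.
  (Z.0≤i-j⇒j≤i (subst (λ d → + 0 Z.≤ d) (first a₀ a₃ (+ n)) (Z.i≤j⇒0≤j-i g₄)))
  (Z.0≤i-j⇒j≤i (subst (λ d → + 0 Z.≤ d) (second a₀ a₁ (+ n)) (Z.i≤j⇒0≤j-i g₁)))
  where
  open +-*-Solver
  first : ∀ a b m → m - + 2 - (b - a) ≡ a Z.+ m - b - + 2
  first = solve 3 (λ a b m → m :- con (+ 2) :- (b :- a) := a :+ m :- b :- con (+ 2)) refl
  second : ∀ a b m → b - a - + 2 ≡ m - + 2 - (a Z.+ m - b)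
  second = solve 3 (λ a b m → b :- a :- con (+ 2) := m :- con (+ 2) :- (a :+ m :- b)) refl

module _ (k : ℕ) where
  private
    n = suc k
  open Residues k

  private
    interval-from : ∀ a b i → InInterval n a b i → InInterval n (a Z.+ + n) b i
    interval-from a b i = subst₂ _≤_
      (sym (modN-periodic (+ toℕ i - a) (Z.- + 1) (lemma (+ toℕ i) a (+ n))))
      (sym (modN-periodic (b - a) (Z.- + 1) (lemma b a (+ n))))
      where
      open +-*-Solver
      lemma : ∀ z a m → z - (a Z.+ m) ≡ z - a Z.+ (Z.- + 1) Z.* m
      lemma = solve 3 (λ z a m → z :- (a :+ m) := z :- a :+ (:- con (+ 1)) :* m) refl

    interval-to : ∀ a b i → InInterval n a (b - + 1) i → InInterval n a (b Z.+ + n - + 1) i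
    interval-to a b i = subst (modN (+ toℕ i - a) n ≤_)
      (sym (modN-periodic (b - + 1 - a) (+ 1) (lemma b a (+ n))))
      where
      open +-*-Solver
      lemma : ∀ b a m → b Z.+ m - + 1 - a ≡ b - + 1 - a Z.+ + 1 Z.* m
      lemma = solve 3 (λ b a m → b :+ m :- con (+ 1) :- a := b :- con (+ 1) :- a :+ con (+ 1) :* m) refl

  -- The facets are the same intervals in cyclic order; replacing `a₀` by `a₀ + n` changes no
  -- residue.
  K4-rotate : ∀ a₀ a₁ a₂ a₃ → K4 n a₀ a₁ a₂ a₃ ⊑ K4 n a₁ a₂ a₃ (a₀ Z.+ + n)
  K4-rotate a₀ a₁ a₂ a₃ S (inj₁ S⊆)               = inj₂ (inj₁ S⊆)
  K4-rotate a₀ a₁ a₂ a₃ S (inj₂ (inj₁ S⊆))        = inj₂ (inj₂ (inj₁ S⊆))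
  K4-rotate a₀ a₁ a₂ a₃ S (inj₂ (inj₂ (inj₁ S⊆))) =
    inj₂ (inj₂ (inj₂ λ i i∈S → interval-to a₁ a₀ i (S⊆ i i∈S)))
  K4-rotate a₀ a₁ a₂ a₃ S (inj₂ (inj₂ (inj₂ S⊆))) =
    inj₁ λ i i∈S → interval-from a₀ (a₃ - + 1) i (S⊆ i i∈S)

  K4-minimal : ∀ {a₀ a₁ a₂ a₃} → Separated n a₀ a₁ a₂ a₃ →
    ∀ K → IsComplex K → K ⊏ K4 n a₀ a₁ a₂ a₃ → ¬ Generates K (Mon n)
  K4-minimal {a₀} {a₁} {a₂} {a₃} sep K complex (K⊑ , S , S∈K4 , S∉K) = by-facet S∈K4
    where
    sep₁ = separated-rotate sep
    sep₂ = separated-rotate sep₁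
    sep₃ = separated-rotate sep₂
    K⊑₁ : K ⊑ K4 n a₁ a₂ a₃ (a₀ Z.+ + n)
    K⊑₁ T = K4-rotate a₀ a₁ a₂ a₃ T ∘ K⊑ T
    K⊑₂ : K ⊑ K4 n a₂ a₃ (a₀ Z.+ + n) (a₁ Z.+ + n)
    K⊑₂ T = K4-rotate a₁ a₂ a₃ (a₀ Z.+ + n) T ∘ K⊑₁ T
    K⊑₃ : K ⊑ K4 n a₃ (a₀ Z.+ + n) (a₁ Z.+ + n) (a₂ Z.+ + n)
    K⊑₃ T = K4-rotate a₂ a₃ (a₀ Z.+ + n) (a₁ Z.+ + n) T ∘ K⊑₂ T
    by-facet : K4 n a₀ a₁ a₂ a₃ S → ¬ Generates K (Mon n)
    -- The facets omitting `A₀`, `A₁`, `A₂`, `A₃` come to omit the first arc after 0, 1, 2, 3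
    -- rotations.
    by-facet (inj₂ (inj₂ (inj₁ S⊆))) = Complex.not-generating k sep K complex K⊑ S S⊆ S∉K
    by-facet (inj₂ (inj₁ S⊆))        = Complex.not-generating k sep₁ K complex K⊑₁ S S⊆ S∉K
    by-facet (inj₁ S⊆)               = Complex.not-generating k sep₂ K complex K⊑₂ S S⊆ S∉K
    by-facet (inj₂ (inj₂ (inj₂ S⊆))) = Complex.not-generating k sep₃ K complex K⊑₃ S
      (λ i i∈S → interval-from a₀ (a₃ - + 1) i (S⊆ i i∈S)) S∉K

theorem6p13 : (n : ℕ) → 8 ≤ n → (a₀ a₁ a₂ a₃ : ℤ) →
    + 2 Z.≤ a₁ - a₀ → + 2 Z.≤ a₂ - a₁ → + 2 Z.≤ a₃ - a₂ → a₃ - a₀ Z.≤ + n - + 2 →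
    MinimalGenerating (K4 n a₀ a₁ a₂ a₃) (Mon n)
theorem6p13 (suc k) _ a₀ a₁ a₂ a₃ g₁ g₂ g₃ g₄ =
  Complex.K4-generates k sep , K4-minimal k sep
  where
  sep : Separated (suc k) a₀ a₁ a₂ a₃
  sep = separated g₁ g₂ g₃ g₄
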